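{- For every $\mathcal{V}$-poset $P$, \[\mathcal{P}(P;x,y)=L(P;x,y):=\sum_{A\in\mathcal{A}(P)}x^{b(A)}y^{s(A)}.\]
   Context: All posets are finite. A $\mathcal{V}$-poset is a poset generated from the empty poset by repeatedly applying: disjoint union of $\mathcal{V}$-posets, adding a new greatest element, adding a new least element. The polynomial $\mathcal{P}$ is defined on $\mathcal{V}$-posets by: $\mathcal{P}(\emptyset;x,y)=1$; $\mathcal{P}(\bullet;x,y)=x$ for the one-element poset; $\mathcal{P}(\bigcup_iP_i;x,y)=\prod_i\mathcal{P}(P_i;x,y)$ for a disjoint union; and $\mathcal{P}(P\cup\{g\};x,y)=\mathcal{P}(P\cup\{\ell\};x,y)=\mathcal{P}(P;x,y)+y^{|P|}$ where $g$ (resp. $\ell$) is a new greatest (resp. least) element. An element $x$ is basic if: (B.1) there are no two incomparable elements $u,v$ with $x>u$ and $x>v$; (B.2) there are no two incomparable elements $u,v$ with $x<u$ and $x<v$; (B.3) there is no element $u$ with $u<x$ such that for all $w\neq u,x$ one has ($u\ge w\iff x\ge w$) and ($u\le w\iff x\le w$). An element is associated to a set $B$ of basic elements if it is comparable to every element of $B$ and incomparable to every other basic element. A non-basic element $u$ is upper if $u>b$ for some basic $b$, and lower if $u<b$ for some basic $b$. For $a\in P$: if $a$ is basic, $P_a=\emptyset$; otherwise let $B$ be the set of basic elements to which $a$ is associated; if $a$ is lower, $P_a=\{b\in P: a<b,\ \text{there is no } c \text{ with } c<b \text{ and } c \text{ incomparable to } a\}$; if $a$ is upper, $P_a=\{b\in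 P: a>b,\ \text{there is no } c \text{ with } c>b \text{ and } c \text{ incomparable to } a\}\setminus\{\ell\in P: \ell \text{ is a lower element associated to } B\}$. $\mathcal{A}(P)$ is the set of maximal antichains of $P$ (antichain: pairwise incomparable elements; maximal: not properly contained in another antichain). For $A\in\mathcal{A}(P)$, $b(A)$ is the number of basic elements in $A$ and $s(A)=\sum_{a\in A}|P_a|$. -}

module Defs where

open import Level using (0ℓ; suc)
open import Data.Nat.Base as ℕ using (ℕ)
import Data.Nat.Properties as ℕₚ
open import Data.Nat.ListAction using (sum)
open import Data.Bool.Base using (true; false)
open import Data.Fin.Base using (Fin)
open import Data.Fin.Properties using (_≟_; all?; any?)
open import Data.Fin.Subset using (Subset; _∈_; _⊂_)
open import Data.Fin.Subset.Properties using (_∈?_; _⊂?_; anySubset?)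
open import Data.List.Base using (List; []; _∷_; _++_; map; filter; length; allFin; cartesianProductWith)
open import Data.Product.Base using (_×_; _,_; ∃-syntax)
open import Data.Product.Properties using (≡-dec)
open import Data.Sum.Base using (_⊎_)
open import Data.Sum.Relation.Binary.Pointwise using (Pointwise)
import Data.Vec.Base as Vec
open import Relation.Binary.Core using (Rel)
open import Relation.Binary.Structures using (IsDecPartialOrder)
open import Relation.Binary.Morphism.Structures using (IsOrderIsomorphism)
open import Relation.Binary.PropositionalEquality.Core using (_≡_; _≢_)
import Relation.Binary.Construct.Add.Supremum.NonStrict as Sup
import Relation.Binary.Construct.Add.Infimum.NonStrict as Inf
open import Relation.Nullary.Decidable using (Dec; ¬?; _×-dec_; _⊎-dec_; _→-dec_)
open import Relation.Nullary.Negation.Core using (¬_)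
open import Relation.Unary using (Pred; Decidable)

-- Polynomials in x, y with natural number coefficients, as formal sums of
-- monomials: (i , j) stands for xⁱyʲ, and repetitions encode coefficients.

Poly : Set
Poly = List (ℕ × ℕ)

infixl 6 _⊕_
infixl 7 _⊗_
infix  4 _≈_

1ₚ X : Poly
1ₚ = (0 , 0) ∷ []
X  = (1 , 0) ∷ []

Y^_ : ℕ → Poly
Y^ n = (0 , n) ∷ []

_⊕_ _⊗_ : Poly → Poly → Poly
p ⊕ q = p ++ q
p ⊗ q = cartesianProductWith (λ (i , j) (k , l) → (i ℕ.+ k , j ℕ.+ l)) p q

coeff : Poly → ℕ → ℕ → ℕ
coeff p i j = length (filter (λ m → ≡-dec ℕₚ._≟_ ℕₚ._≟_ m (i , j)) p)

_≈_ : Rel Poly 0ℓ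
p ≈ q = ∀ i j → coeff p i j ≡ coeff q i j

record FinPoset : Set (suc 0ℓ) where
  field
    size              : ℕ
    _≤_               : Rel (Fin size) 0ℓ
    isDecPartialOrder : IsDecPartialOrder _≡_ _≤_

  open IsDecPartialOrder isDecPartialOrder public using (_≤?_)

  Carrier : Set
  Carrier = Fin size

-- P ≅ _≲_ : the poset P is order isomorphic to (A , _≲_).

infix 4 _≅_

_≅_ : FinPoset → {A : Set} → Rel A 0ℓ → Set
P ≅ _≲_ = ∃[ f ] IsOrderIsomorphism _≡_ _≡_ (FinPoset._≤_ P) _≲_ f

-- Being generated is closed under isomorphism, so each constructor applies to
-- every R isomorphic to the poset constructed.  Larger disjoint unions are
-- iterated binary ones.

data 𝒱-Poset : FinPoset → Set (suc 0ℓ) where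
  empty    : ∀ {R} → FinPoset.size R ≡ 0 → 𝒱-Poset R
  union    : ∀ {P Q R} → 𝒱-Poset P → 𝒱-Poset Q →
             R ≅ Pointwise (FinPoset._≤_ P) (FinPoset._≤_ Q) → 𝒱-Poset R
  greatest : ∀ {P R} → 𝒱-Poset P →
             R ≅ Sup._≤⁺_ (FinPoset._≤_ P) → 𝒱-Poset R
  least    : ∀ {P R} → 𝒱-Poset P →
             R ≅ Inf._≤₋_ (FinPoset._≤_ P) → 𝒱-Poset R

-- Adding an extremum to the empty poset gives the one-element poset, whose
-- polynomial is x; the rule 𝒫(P) + y^|P| is for nonempty P only.

extend : (size : ℕ) → Poly → Poly
extend ℕ.zero      p = X
extend n@(ℕ.suc _) p = p ⊕ Y^ n

-- 𝒫 is computed along a given construction of the poset.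

𝒫 : ∀ {P} → 𝒱-Poset P → Poly
𝒫 (empty _)              = 1ₚ
𝒫 (union v w _)          = 𝒫 v ⊗ 𝒫 w
𝒫 (greatest {P = P} v _) = extend (FinPoset.size P) (𝒫 v)
𝒫 (least {P = P} v _)    = extend (FinPoset.size P) (𝒫 v)

subsets : ∀ n → List (Subset n)
subsets ℕ.zero    = Vec.[] ∷ []
subsets (ℕ.suc n) = map (false Vec.∷_) (subsets n) ++ map (true Vec.∷_) (subsets n)

module _ (P : FinPoset) where
  open FinPoset P

  infix 4 _<_ _<?_

  _<_ Comparable Incomparable : Rel Carrier 0ℓ
  u < v            = u ≤ v × u ≢ v
  Comparable u v   = u ≤ v ⊎ v ≤ u
  Incomparable u v = ¬ Comparable u v

  B1 B2 B3 Basic : Pred Carrier 0ℓ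
  B1 x = ¬ (∃[ u ] ∃[ v ] Incomparable u v × u < x × v < x)
  B2 x = ¬ (∃[ u ] ∃[ v ] Incomparable u v × x < u × x < v)
  B3 x = ¬ (∃[ u ] u < x × (∀ w → w ≢ u → w ≢ x →
           ((w ≤ u → w ≤ x) × (w ≤ x → w ≤ u)) ×
           ((u ≤ w → x ≤ w) × (x ≤ w → u ≤ w))))
  Basic x = B1 x × B2 x × B3 x

  -- Only used with B a set of basic elements.
  AssociatedTo : Carrier → Pred Carrier 0ℓ → Set
  AssociatedTo a B = (∀ b → B b → Comparable a b) ×
                     (∀ b → Basic b → ¬ B b → Incomparable a b)

  -- The unique set of basic elements to which a is associated.
  BasicsOf : Carrier → Pred Carrier 0ℓ
  BasicsOf a b = Basic b × Comparable a b

  Upper Lower : Pred Carrier 0ℓ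
  Upper u = ¬ Basic u × (∃[ b ] Basic b × b < u)
  Lower u = ¬ Basic u × (∃[ b ] Basic b × u < b)

  -- InP a b : b ∈ P_a.  Empty for basic a, as such a is neither lower nor upper.
  InP : Carrier → Pred Carrier 0ℓ
  InP a b =
    (Lower a × a < b × ¬ (∃[ c ] c < b × Incomparable c a)) ⊎
    (Upper a × b < a × ¬ (∃[ c ] b < c × Incomparable c a)
             × ¬ (Lower b × AssociatedTo b (BasicsOf a)))

  Antichain MaximalAntichain : Pred (Subset size) 0ℓ
  Antichain A        = ∀ u v → u ∈ A → v ∈ A → u ≢ v → Incomparable u v
  MaximalAntichain A = Antichain A × ¬ (∃[ A′ ] Antichain A′ × A ⊂ A′)

  _<?_ : ∀ u v → Dec (u < v)
  u <? v = (u ≤? v) ×-dec ¬? (u ≟ v)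

  comparable? : ∀ u v → Dec (Comparable u v)
  comparable? u v = (u ≤? v) ⊎-dec (v ≤? u)

  incomparable? : ∀ u v → Dec (Incomparable u v)
  incomparable? u v = ¬? (comparable? u v)

  B1? : Decidable B1
  B1? x = ¬? (any? λ u → any? λ v → incomparable? u v ×-dec (u <? x) ×-dec (v <? x))

  B2? : Decidable B2
  B2? x = ¬? (any? λ u → any? λ v → incomparable? u v ×-dec (x <? u) ×-dec (x <? v))

  B3? : Decidable B3
  B3? x = ¬? (any? λ u → (u <? x) ×-dec all? λ w → ¬? (w ≟ u) →-dec ¬? (w ≟ x) →-dec
    (((w ≤? u) →-dec (w ≤? x)) ×-dec ((w ≤? x) →-dec (w ≤? u))) ×-dec
    (((u ≤? w) →-dec (x ≤? w)) ×-dec ((x ≤? w) →-dec (u ≤? w))))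

  basic? : Decidable Basic
  basic? x = B1? x ×-dec B2? x ×-dec B3? x

  associatedTo? : ∀ a {B} → Decidable B → Dec (AssociatedTo a B)
  associatedTo? a B? =
    (all? λ b → B? b →-dec comparable? a b) ×-dec
    (all? λ b → basic? b →-dec ¬? (B? b) →-dec incomparable? a b)

  basicsOf? : ∀ a → Decidable (BasicsOf a)
  basicsOf? a b = basic? b ×-dec comparable? a b

  upper? : Decidable Upper
  upper? u = ¬? (basic? u) ×-dec (any? λ b → basic? b ×-dec (b <? u))

  lower? : Decidable Lower
  lower? u = ¬? (basic? u) ×-dec (any? λ b → basic? b ×-dec (u <? b))

  inP? : ∀ a → Decidable (InP a)
  inP? a b =
    (lower? a ×-dec (a <? b) ×-dec ¬? (any? λ c → (c <? b) ×-dec incomparable? c a)) ⊎-dec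
    (upper? a ×-dec (b <? a) ×-dec ¬? (any? λ c → (b <? c) ×-dec incomparable? c a)
              ×-dec ¬? (lower? b ×-dec associatedTo? b (basicsOf? a)))

  antichain? : Decidable Antichain
  antichain? A = all? λ u → all? λ v →
    (u ∈? A) →-dec (v ∈? A) →-dec ¬? (u ≟ v) →-dec incomparable? u v

  maximalAntichain? : Decidable MaximalAntichain
  maximalAntichain? A =
    antichain? A ×-dec ¬? (anySubset? λ A′ → antichain? A′ ×-dec (A ⊂? A′))

  𝒜 : List (Subset size)
  𝒜 = filter maximalAntichain? (subsets size)

  elements : Subset size → List Carrier
  elements A = filter (_∈? A) (allFin size)

  ∣P∣ : Carrier → ℕ
  ∣P∣ a = length (filter (inP? a) (allFin size))

  b s : Subset size → ℕ
  b A = length (filter basic? (elements A))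
  s A = sum (map ∣P∣ (elements A))

  L : Poly
  L = map (λ A → (b A , s A)) 𝒜

{-# OPTIONS --safe #-}
module Submission where

-- By induction along the construction, 𝒫 and L agree as multisets of monomials.
-- In a 𝒱-poset the basic elements form an antichain, which is nonempty unless the
-- poset is, and an element comparable to all of them is comparable to everything;
-- these three facts are carried through the induction.
--
-- Disjoint union: maximal antichains are unions of maximal antichains of the parts.
-- New extremum z, P not a chain: {z} is the only new maximal antichain and the basic
-- elements do not change.  A least element ℓ has P_ℓ = P, giving y^|P|, and no other
-- P_a changes.  A greatest element g shifts the exponents of the k lower elements
-- comparable to everything, from |P|-1, …, |P|-k to |P|, …, |P|-k+1, and since P_g
-- omits exactly these k elements, {g} contributes the missing y^(|P|-k).
-- Chains: (B.3) makes the minimum the only basic element and |P_a| is the height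
-- of a, so L = x + y + … + y^(n-1) depends on the size only.

open import Defs

open import Data.Bool.Base using (true; false)
open import Data.Empty using (⊥-elim)
open import Data.Fin.Base using (Fin; zero; suc)
open import Data.Fin.Properties as Finₚ using (_≟_; all?; any?)
open import Data.Fin.Subset using (Subset; _∈_; _∪_; ⁅_⁆)
open import Data.Fin.Subset.Properties using (_∈?_; ⊆-antisym; x∈⁅x⁆; x∈⁅y⁆⇒x≡y; x∈p∪q⁻; x∈p∪q⁺)
open import Data.List.Base using (List; []; _∷_; _++_; map; filter; length; allFin; upTo; applyUpTo; cartesianProductWith)
open import Data.List.Membership.Propositional using () renaming (_∈_ to _∈ₗ_)
open import Data.List.Membership.Propositional.Properties
  using (∈-map⁺; ∈-map⁻; ∈-++⁺ˡ; ∈-++⁺ʳ; ∈-++⁻; ∈-filter⁺; ∈-filter⁻; ∈-allFin; ∈-upTo⁺;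
         ∈-∃++; ∈-cartesianProductWith⁺; ∈-cartesianProductWith⁻)
open import Data.List.Membership.Propositional.Properties.WithK using (unique∧set⇒bag)
open import Data.List.Properties
  using (length-++; length-map; map-++; map-∘; map-cong; map-cong-local; length-upTo; upTo-∷ʳ;
         map-upTo; length-tabulate; ++-identityʳ; filter-accept; filter-reject;
         filter-none; filter-all; filter-++)
open import Data.List.Relation.Binary.BagAndSetEquality using (∼bag⇒↭)
open import Data.List.Relation.Binary.Permutation.Propositional
  using (_↭_; ↭-refl; ↭-sym; ↭-trans; ↭-reflexive; prep; swap; module PermutationReasoning)
  renaming (refl to ↭refl; trans to ↭trans)
open import Data.List.Relation.Binary.Permutation.Propositional.Properties
  using (map⁺; ↭-length; ++⁺; ++⁺ˡ; ++⁺ʳ; shift; shifts; filter-↭; ∈-resp-↭; ∷↭∷ʳ; ↭-singleton-inv)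
open import Data.List.Relation.Unary.All as All using (All; []; _∷_)
open import Data.List.Relation.Unary.AllPairs using ([]; _∷_)
open import Data.List.Relation.Unary.Any using (here; there)
open import Data.List.Relation.Unary.Unique.Propositional using (Unique)
import Data.List.Relation.Unary.Unique.Propositional.Properties as Unique
open import Data.Nat.Base as ℕ using (ℕ; zero; suc; z≤n; s≤s; _+_; _∸_)
import Data.Nat.Properties as ℕₚ
open import Data.Nat.ListAction using (sum)
open import Data.Nat.ListAction.Properties using (sum-↭; sum-++)
open import Data.Product.Base using (_×_; _,_; ∃-syntax; proj₁; proj₂)
open import Data.Product.Properties using (≡-dec)
open import Data.Sum.Base using (_⊎_; inj₁; inj₂; [_,_]′)
open import Data.Sum.Relation.Binary.Pointwise as Pw using (Pointwise)
open import Data.Unit.Base using (⊤; tt)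
open import Data.Vec.Base as Vec using (tabulate)
open import Data.Vec.Properties as Vecₚ using (lookup∘tabulate; []=⇒lookup; lookup⇒[]=)
open import Function.Base using (_∘_; id; case_of_)
open import Function.Bundles using (mk⇔)
open import Level using (0ℓ)
open import Relation.Binary.Core using (Rel)
import Relation.Binary.Construct.Add.Infimum.NonStrict as Inf
import Relation.Binary.Construct.Add.Supremum.NonStrict as Sup
open import Relation.Binary.Morphism.Structures using (IsOrderIsomorphism)
open import Relation.Binary.PropositionalEquality
open import Relation.Binary.Structures using (IsDecPartialOrder)
open import Relation.Nullary.Construct.Add.Infimum using (⊥₋)
open import Relation.Nullary.Construct.Add.Supremum using (⊤⁺; [_])
open import Relation.Nullary.Decidable using (Dec; yes; no; does; ¬?; _×-dec_; dec-true; decidable-stable)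
open import Relation.Nullary.Negation using (¬_; contradiction)
open import Relation.Unary using (Pred; Decidable)

private variable
  C E : Set
  xs ys : List C

-- Duplicate-free lists

↭-of-unique : Unique xs → Unique ys →
              (∀ {x} → x ∈ₗ xs → x ∈ₗ ys) → (∀ {x} → x ∈ₗ ys → x ∈ₗ xs) → xs ↭ ys
↭-of-unique uxs uys f g = ∼bag⇒↭ (unique∧set⇒bag uxs uys (mk⇔ f g))

-- Each entry of `xs` is cut out of `ys` at one occurrence; as `xs` has no duplicates, its later
-- entries survive the cut.
unique-⊆ : ∀ {C : Set} {xs ys : List C} → Unique xs → (∀ {x} → x ∈ₗ xs → x ∈ₗ ys) → ∃[ zs ] ys ↭ xs ++ zs
unique-⊆ {xs = []}     {ys} _ _ = ys , ↭-refl
unique-⊆ {xs = x ∷ xs} (x≢ ∷ u) f with ∈-∃++ (f (here refl))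
... | as , bs , refl with unique-⊆ {xs = xs} {as ++ bs} u (λ {y} y∈ → aux y∈ (∈-resp-↭ (shift x as bs) (f (there y∈))))
  where
  aux : ∀ {y} → y ∈ₗ xs → y ∈ₗ x ∷ as ++ bs → y ∈ₗ as ++ bs
  aux y∈ (here refl) = contradiction refl (All.lookup x≢ y∈)
  aux y∈ (there p)   = p
... | zs , p = zs , ↭-trans (shift x as bs) (prep x p)

unique-⊆-length : Unique xs → (∀ {x} → x ∈ₗ xs → x ∈ₗ ys) → length xs ℕ.≤ length ys
unique-⊆-length {xs = xs} u f with unique-⊆ u f
... | zs , p = subst (length xs ℕ.≤_) (sym (trans (↭-length p) (length-++ xs))) (ℕₚ.m≤m+n _ _)

-- Pigeonhole: the length bound leaves no room for a remainder in `unique-⊆`.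
unique-⊆-↭ : Unique xs → (∀ {x} → x ∈ₗ xs → x ∈ₗ ys) → length ys ℕ.≤ length xs → xs ↭ ys
unique-⊆-↭ {xs = xs} u f le with unique-⊆ u f
... | []     , p = ↭-sym (↭-trans p (↭-reflexive (++-identityʳ xs)))
... | z ∷ zs , p = contradiction
  (ℕₚ.≤-trans (ℕₚ.≤-reflexive (trans (sym (ℕₚ.+-suc _ _)) (sym (trans (↭-length p) (length-++ xs))))) le)
  (ℕₚ.m+1+n≰m (length xs) ∘ subst (ℕ._≤ length xs) (sym (ℕₚ.+-suc _ _)))

-- Injectivity is asked for on the list only, because heights are known to separate elements only
-- when these are comparable.
map-unique-local : {f : C → E} → (∀ {x y} → x ∈ₗ xs → y ∈ₗ xs → f x ≡ f y → x ≡ y) →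
                   Unique xs → Unique (map f xs)
map-unique-local inj []       = []
map-unique-local {f = f} inj (x≢ ∷ u) =
  All.tabulate (λ fy∈ eq → let y , y∈ , eq′ = ∈-map⁻ f fy∈ in
    All.lookup x≢ y∈ (inj (here refl) (there y∈) (trans eq eq′))) ∷
  map-unique-local (λ p q → inj (there p) (there q)) u

filter-partition-↭ : {Q : Pred C 0ℓ} (Q? : Decidable Q) (xs : List C) →
                     xs ↭ filter Q? xs ++ filter (¬? ∘ Q?) xs
filter-partition-↭ Q? []       = ↭-refl
filter-partition-↭ Q? (x ∷ xs) with Q? x
... | yes q = prep x (filter-partition-↭ Q? xs)
... | no ¬q = ↭-trans (prep x (filter-partition-↭ Q? xs)) (↭-sym (shift x (filter Q? xs) _))

filter-map : {Q : Pred C 0ℓ} (Q? : Decidable Q) {S : Pred E 0ℓ} (S? : Decidable S) {f : C → E} →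
             (∀ {x} → Q x → S (f x)) → (∀ {x} → S (f x) → Q x) →
             ∀ xs → filter S? (map f xs) ≡ map f (filter Q? xs)
filter-map Q? S? Q⇒S S⇒Q []       = refl
filter-map Q? S? Q⇒S S⇒Q (x ∷ xs) with Q? x
... | yes q = trans (filter-accept S? (Q⇒S q)) (cong (_ ∷_) (filter-map Q? S? Q⇒S S⇒Q xs))
... | no ¬q = trans (filter-reject S? (¬q ∘ S⇒Q)) (filter-map Q? S? Q⇒S S⇒Q xs)

-- Polynomials

-- The induction works with permutations of lists of monomials; coefficients are multiplicities, and
-- a permutation preserves these.
↭⇒≈ : ∀ {p q : Poly} → p ↭ q → p ≈ q
↭⇒≈ p↭q i j = ↭-length (filter-↭ (λ m → ≡-dec ℕₚ._≟_ ℕₚ._≟_ m (i , j)) p↭q)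

module _ {C D E : Set} (f : C → D → E) where
  cartesianProductWith-↭ˡ : ∀ {xs xs′} ys → xs ↭ xs′ → cartesianProductWith f xs ys ↭ cartesianProductWith f xs′ ys
  cartesianProductWith-↭ˡ ys ↭refl        = ↭-refl
  cartesianProductWith-↭ˡ ys (prep x p)   = ++⁺ˡ (map (f x) ys) (cartesianProductWith-↭ˡ ys p)
  cartesianProductWith-↭ˡ ys (swap x y p) = ↭-trans
    (++⁺ˡ (map (f x) ys) (++⁺ˡ (map (f y) ys) (cartesianProductWith-↭ˡ ys p)))
    (shifts (map (f x) ys) (map (f y) ys))
  cartesianProductWith-↭ˡ ys (↭trans p q) = ↭-trans (cartesianProductWith-↭ˡ ys p) (cartesianProductWith-↭ˡ ys q)

  cartesianProductWith-↭ʳ : ∀ xs {ys ys′} → ys ↭ ys′ → cartesianProductWith f xs ys ↭ cartesianProductWith f xs ys′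
  cartesianProductWith-↭ʳ []       p = ↭-refl
  cartesianProductWith-↭ʳ (x ∷ xs) p = ++⁺ (map⁺ (f x) p) (cartesianProductWith-↭ʳ xs p)

module _ {C D E C′ D′ E′ : Set} {f : C → D → E} {g : C′ → D′ → E′}
         {h : C → C′} {k : D → D′} {l : E → E′} (hom : ∀ x y → l (f x y) ≡ g (h x) (k y)) where
  map-cartesianProductWith : ∀ xs ys → map l (cartesianProductWith f xs ys) ≡ cartesianProductWith g (map h xs) (map k ys)
  map-cartesianProductWith []       ys = refl
  map-cartesianProductWith (x ∷ xs) ys = trans (map-++ l (map (f x) ys) _) (cong₂ _++_
    (trans (sym (map-∘ ys)) (trans (map-cong (hom x) ys) (map-∘ ys)))
    (map-cartesianProductWith xs ys))

-- Subsets

module _ {n} {Q : Pred (Fin n) 0ℓ} (Q? : Decidable Q) where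
  comprehension : Subset n
  comprehension = tabulate (does ∘ Q?)

  ∈-comprehension⁺ : ∀ {x} → Q x → x ∈ comprehension
  ∈-comprehension⁺ {x} q = lookup⇒[]= x _ (trans (lookup∘tabulate _ x) (dec-true (Q? x) q))

  ∈-comprehension⁻ : ∀ {x} → x ∈ comprehension → Q x
  ∈-comprehension⁻ {x} x∈ with Q? x | trans (sym (lookup∘tabulate (does ∘ Q?) x)) ([]=⇒lookup x∈)
  ... | yes q | _ = q

∈-subsets : ∀ {n} (A : Subset n) → A ∈ₗ subsets n
∈-subsets Vec.[]          = here refl
∈-subsets (false Vec.∷ A) = ∈-++⁺ˡ (∈-map⁺ _ (∈-subsets A))
∈-subsets (true Vec.∷ A)  = ∈-++⁺ʳ (map (false Vec.∷_) (subsets _)) (∈-map⁺ _ (∈-subsets A))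

subsets-unique : ∀ n → Unique (subsets n)
subsets-unique zero    = [] ∷ []
subsets-unique (suc n) = Unique.++⁺
  (Unique.map⁺ Vecₚ.∷-injectiveʳ (subsets-unique n)) (Unique.map⁺ Vecₚ.∷-injectiveʳ (subsets-unique n))
  λ (p , q) → clash (∈-map⁻ _ p) (∈-map⁻ _ q)
  where
  clash : ∀ {v : Subset (suc n)} → ∃[ A ] A ∈ₗ subsets n × v ≡ false Vec.∷ A →
          ¬ (∃[ A ] A ∈ₗ subsets n × v ≡ true Vec.∷ A)
  clash (_ , _ , refl) (_ , _ , ())

⁅⁆-injective : ∀ {n} {x y : Fin n} → ⁅ x ⁆ ≡ ⁅ y ⁆ → x ≡ y
⁅⁆-injective {x = x} {y} eq = x∈⁅y⁆⇒x≡y y (subst (x ∈_) eq (x∈⁅x⁆ x))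

∈-filter-allFin : ∀ {n} {Q : Pred (Fin n) 0ℓ} (Q? : Decidable Q) {x} → Q x → x ∈ₗ filter Q? (allFin n)
∈-filter-allFin Q? {x} = ∈-filter⁺ Q? (∈-allFin x)

filter-allFin-unique : ∀ {n} {Q : Pred (Fin n) 0ℓ} (Q? : Decidable Q) → Unique (filter Q? (allFin n))
filter-allFin-unique {n} Q? = Unique.filter⁺ Q? (Unique.allFin⁺ n)

module _ {m n} {Q : Pred (Fin n) 0ℓ} (Q? : Decidable Q) {S : Pred (Fin m) 0ℓ} (S? : Decidable S)
         {f : Fin n → Fin m} (injective : ∀ {x y} → f x ≡ f y → x ≡ y) (Q⇒S : ∀ {x} → Q x → S (f x)) where
  private
    unique : Unique (map f (filter Q? (allFin n)))
    unique = Unique.map⁺ injective (filter-allFin-unique Q?)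

    from : ∀ {y} → y ∈ₗ map f (filter Q? (allFin n)) → y ∈ₗ filter S? (allFin m)
    from y∈ with x , x∈ , refl ← ∈-map⁻ f y∈ =
      ∈-filter-allFin S? (Q⇒S (proj₂ (∈-filter⁻ Q? {xs = allFin n} x∈)))

  -- Moves enumerations of decidable subsets along an injection. The element lists of images and the
  -- cardinalities of the sets `P_a` are compared between posets in this way.
  filter-allFin-↭-map : (∀ {y} → S y → ∃[ x ] y ≡ f x × Q x) →
                        filter S? (allFin m) ↭ map f (filter Q? (allFin n))
  filter-allFin-↭-map S⇒Q = ↭-of-unique (filter-allFin-unique S?) unique to from
    where
    to : ∀ {y} → y ∈ₗ filter S? (allFin m) → y ∈ₗ map f (filter Q? (allFin n))
    to y∈ with x , refl , q ← S⇒Q (proj₂ (∈-filter⁻ S? {xs = allFin m} y∈)) = ∈-map⁺ f (∈-filter-allFin Q? q)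

  filter-allFin-↭-∷map : ∀ {z} → S z → (∀ x → z ≢ f x) → (∀ {y} → S y → y ≡ z ⊎ (∃[ x ] y ≡ f x × Q x)) →
                         filter S? (allFin m) ↭ z ∷ map f (filter Q? (allFin n))
  filter-allFin-↭-∷map {z} sz z≢ S⇒Q = ↭-of-unique (filter-allFin-unique S?)
    (All.tabulate (λ y∈ z≡y → let x , _ , eq = ∈-map⁻ f y∈ in z≢ x (trans z≡y eq)) ∷ unique) to
    λ where (here refl) → ∈-filter-allFin S? sz
            (there y∈)  → from y∈
    where
    to : ∀ {y} → y ∈ₗ filter S? (allFin m) → y ∈ₗ z ∷ map f (filter Q? (allFin n))
    to y∈ with S⇒Q (proj₂ (∈-filter⁻ S? {xs = allFin m} y∈))
    ... | inj₁ refl           = here refl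
    ... | inj₂ (x , refl , q) = there (∈-map⁺ f (∈-filter-allFin Q? q))

  length-filter-allFin : (∀ {y} → S y → ∃[ x ] y ≡ f x × Q x) →
                         length (filter S? (allFin m)) ≡ length (filter Q? (allFin n))
  length-filter-allFin S⇒Q = trans (↭-length (filter-allFin-↭-map S⇒Q)) (length-map f (filter Q? (allFin n)))

length-allFin : ∀ n → length (allFin n) ≡ n
length-allFin n = length-tabulate id

-- Posets

module _ (P : FinPoset) where
  open FinPoset P
  open IsDecPartialOrder isDecPartialOrder using () renaming (refl to ≤-refl; trans to ≤-trans; antisym to ≤-antisym)

  Universal : Pred Carrier 0ℓ
  Universal a = ∀ w → Comparable P a w

  Chain : Set
  Chain = ∀ u → Universal u

  universal? : Decidable Universal
  universal? a = all? (comparable? P a)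

  chain? : Dec Chain
  chain? = all? universal?

  comparable-refl : ∀ {u} → Comparable P u u
  comparable-refl = inj₁ ≤-refl

  comparable-sym : ∀ {u v} → Comparable P u v → Comparable P v u
  comparable-sym = [ inj₂ , inj₁ ]′

  ¬incomparable : ∀ {u v} → ¬ Incomparable P u v → Comparable P u v
  ¬incomparable {u} {v} = decidable-stable (comparable? P u v)

  <-irrefl : ∀ {u v} → _<_ P u v → ¬ v ≤ u
  <-irrefl (u≤v , u≢v) v≤u = u≢v (≤-antisym u≤v v≤u)

  <-trans : ∀ {u v w} → _<_ P u v → _<_ P v w → _<_ P u w
  <-trans u<v@(u≤v , _) v<w@(v≤w , _) = ≤-trans u≤v v≤w , λ where refl → <-irrefl u<v v≤w

  comparable⇒≡⊎<⊎> : ∀ {u v} → Comparable P u v → u ≡ v ⊎ _<_ P u v ⊎ _<_ P v u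
  comparable⇒≡⊎<⊎> {u} {v} c with u ≟ v | c
  ... | yes eq | _       = inj₁ eq
  ... | no ne  | inj₁ le = inj₂ (inj₁ (le , ne))
  ... | no ne  | inj₂ ge = inj₂ (inj₂ (ge , ne ∘ sym))

  maximum : ∀ {xs : List Carrier} {x} → x ∈ₗ xs → (∀ {u v} → u ∈ₗ xs → v ∈ₗ xs → Comparable P u v) →
            ∃[ m ] m ∈ₗ xs × (∀ {u} → u ∈ₗ xs → u ≤ m)
  maximum {x ∷ []} _ _ = x , here refl , λ where (here refl) → ≤-refl
  maximum {x ∷ y ∷ xs} _ c with maximum {y ∷ xs} (here refl) (λ p q → c (there p) (there q))
  ... | m , m∈ , ub with c (here refl) (there m∈)
  ...   | inj₁ x≤m = m , there m∈ , λ where (here refl) → x≤m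
                                            (there p)   → ub p
  ...   | inj₂ m≤x = x , here refl , λ where (here refl) → ≤-refl
                                             (there p)   → ≤-trans (ub p) m≤x

  -- A first-order form of maximality: it can be checked element by element, without quantifying
  -- over larger antichains.
  Dominating : Pred (Subset size) 0ℓ
  Dominating A = ∀ r → ∃[ a ] a ∈ A × Comparable P a r

  maximal⁺ : ∀ {A} → Antichain P A → Dominating A → MaximalAntichain P A
  maximal⁺ anti dom = anti , λ where
    (A′ , anti′ , A⊆A′ , r , r∈A′ , r∉A) → let a , a∈A , c = dom r in
      anti′ a r (A⊆A′ a∈A) r∈A′ (λ a≡r → r∉A (subst (_∈ _) a≡r a∈A)) c

  -- If `r` were incomparable to all of `A`, then `A ∪ ⁅ r ⁆` would be a larger antichain.
  maximal⇒dominating : ∀ {A} → MaximalAntichain P A → Dominating A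
  maximal⇒dominating {A} (anti , max) r with any? (λ a → (a ∈? A) ×-dec comparable? P a r)
  ... | yes d = d
  ... | no ¬d = ⊥-elim (max
    (A ∪ ⁅ r ⁆ , anti′ , (x∈p∪q⁺ ∘ inj₁) , r , x∈p∪q⁺ (inj₂ (x∈⁅x⁆ r)) , λ r∈A → ¬d (r , r∈A , comparable-refl)))
    where
    anti′ : Antichain P (A ∪ ⁅ r ⁆)
    anti′ u v u∈ v∈ u≢v c with x∈p∪q⁻ A _ u∈ | x∈p∪q⁻ A _ v∈
    ... | inj₁ u∈A | inj₁ v∈A = anti u v u∈A v∈A u≢v c
    ... | inj₁ u∈A | inj₂ v∈r with refl ← x∈⁅y⁆⇒x≡y r v∈r = ¬d (u , u∈A , c)
    ... | inj₂ u∈r | inj₁ v∈A with refl ← x∈⁅y⁆⇒x≡y r u∈r = ¬d (v , v∈A , comparable-sym c)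
    ... | inj₂ u∈r | inj₂ v∈r = u≢v (trans (x∈⁅y⁆⇒x≡y r u∈r) (sym (x∈⁅y⁆⇒x≡y r v∈r)))

  𝒜-unique : Unique (𝒜 P)
  𝒜-unique = Unique.filter⁺ (maximalAntichain? P) (subsets-unique size)

  ∈𝒜⁺ : ∀ {A} → Antichain P A → Dominating A → A ∈ₗ 𝒜 P
  ∈𝒜⁺ {A} anti dom = ∈-filter⁺ (maximalAntichain? P) (∈-subsets A) (maximal⁺ anti dom)

  ∈𝒜⁻ : ∀ {A} → A ∈ₗ 𝒜 P → Antichain P A × Dominating A
  ∈𝒜⁻ A∈ with max ← proj₂ (∈-filter⁻ (maximalAntichain? P) {xs = subsets size} A∈) = proj₁ max , maximal⇒dominating max

  singleton∈𝒜 : ∀ {a} → Universal a → ⁅ a ⁆ ∈ₗ 𝒜 P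
  singleton∈𝒜 {a} univ = ∈𝒜⁺
    (λ u v u∈ v∈ u≢v → contradiction (trans (x∈⁅y⁆⇒x≡y a u∈) (sym (x∈⁅y⁆⇒x≡y a v∈))) u≢v)
    (λ r → a , x∈⁅x⁆ a , univ r)

  antichain∋universal : ∀ {A a} → Antichain P A → a ∈ A → Universal a → A ≡ ⁅ a ⁆
  antichain∋universal {A} {a} anti a∈A univ = ⊆-antisym
    (λ {u} u∈A → ≡⇒∈ (decidable-stable (u ≟ a) λ u≢a → anti u a u∈A a∈A u≢a (comparable-sym (univ u))))
    (λ u∈a → subst (_∈ A) (sym (x∈⁅y⁆⇒x≡y a u∈a)) a∈A)
    where
    ≡⇒∈ : ∀ {u} → u ≡ a → u ∈ ⁅ a ⁆
    ≡⇒∈ refl = x∈⁅x⁆ a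

  ∈-elements⁺ : ∀ {A a} → a ∈ A → a ∈ₗ elements P A
  ∈-elements⁺ {A} = ∈-filter-allFin (_∈? A)

  ∈-elements⁻ : ∀ {A a} → a ∈ₗ elements P A → a ∈ A
  ∈-elements⁻ {A} a∈ = proj₂ (∈-filter⁻ (_∈? A) {xs = allFin size} a∈)

  elements-unique : ∀ A → Unique (elements P A)
  elements-unique A = filter-allFin-unique (_∈? A)

  elements-singleton : ∀ a → elements P ⁅ a ⁆ ≡ a ∷ []
  elements-singleton a = ↭-singleton-inv (↭-of-unique (elements-unique ⁅ a ⁆) ([] ∷ [])
    (here ∘ x∈⁅y⁆⇒x≡y a ∘ ∈-elements⁻)
    λ where (here refl) → ∈-elements⁺ (x∈⁅x⁆ a))

  weight : Subset size → ℕ × ℕ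
  weight A = b P A , s P A

  weight-singleton-basic : ∀ {a} → Basic P a → weight ⁅ a ⁆ ≡ (1 , ∣P∣ P a)
  weight-singleton-basic {a} bas rewrite elements-singleton a =
    cong₂ _,_ (cong length (filter-accept (basic? P) {xs = []} bas)) (ℕₚ.+-identityʳ _)

  weight-singleton-nonbasic : ∀ {a} → ¬ Basic P a → weight ⁅ a ⁆ ≡ (0 , ∣P∣ P a)
  weight-singleton-nonbasic {a} ¬bas rewrite elements-singleton a =
    cong₂ _,_ (cong length (filter-reject (basic? P) {xs = []} ¬bas)) (ℕₚ.+-identityʳ _)

  -- Heights, and their values on totally ordered down-sets.

  height : Carrier → ℕ
  height a = length (filter (λ u → _<?_ P u a) (allFin size))

  -- The element `a` is not counted in its own height, so `a` followed by the elements below it is a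
  -- duplicate-free list inside `xs`, one longer than `height a`.
  height<length : ∀ {a xs} → a ∈ₗ xs → (∀ {u} → _<_ P u a → u ∈ₗ xs) → height a ℕ.< length xs
  height<length {a} {xs} a∈ f = unique-⊆-length
    (All.tabulate (λ u∈ → λ where refl → proj₂ (below u∈) refl) ∷ filter-allFin-unique (λ u → _<?_ P u a))
    λ where (here refl) → a∈
            (there u∈)  → f (below u∈)
    where
    below : ∀ {u} → u ∈ₗ filter (λ u → _<?_ P u a) (allFin size) → _<_ P u a
    below u∈ = proj₂ (∈-filter⁻ (λ u → _<?_ P u a) {xs = allFin size} u∈)

  height-strictMono : ∀ {u v} → _<_ P u v → height u ℕ.< height v
  height-strictMono {u} {v} u<v = height<length (∈-filter-allFin (λ w → _<?_ P w v) u<v)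
    λ w<u → ∈-filter-allFin (λ w → _<?_ P w v) (<-trans w<u u<v)

  height-injective : ∀ {u v} → Comparable P u v → height u ≡ height v → u ≡ v
  height-injective c eq with comparable⇒≡⊎<⊎> c
  ... | inj₁ u≡v        = u≡v
  ... | inj₂ (inj₁ u<v) = contradiction eq (ℕₚ.<⇒≢ (height-strictMono u<v))
  ... | inj₂ (inj₂ v<u) = contradiction (sym eq) (ℕₚ.<⇒≢ (height-strictMono v<u))

  module _ {Q : Pred Carrier 0ℓ} (Q? : Decidable Q)
           (total : ∀ {u v} → Q u → Q v → Comparable P u v)
           (downward : ∀ {u v} → Q v → _<_ P u v → Q u) where
    private
      U = filter Q? (allFin size)
      Q-of : ∀ {u} → u ∈ₗ U → Q u
      Q-of u∈ = proj₂ (∈-filter⁻ Q? {xs = allFin size} u∈)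

    -- Heights are distinct on pairwise comparable elements, and on a down-set they stay below its
    -- cardinality; by pigeonhole they take every smaller value exactly once.
    map-height-↭ : map height U ↭ upTo (length U)
    map-height-↭ = unique-⊆-↭
      (map-unique-local (λ u∈ v∈ → height-injective (total (Q-of u∈) (Q-of v∈))) (filter-allFin-unique Q?))
      bound
      (ℕₚ.≤-reflexive (trans (length-upTo _) (sym (length-map height U))))
      where
      bound : ∀ {k} → k ∈ₗ map height U → k ∈ₗ upTo (length U)
      bound k∈ with u , u∈ , refl ← ∈-map⁻ height k∈ =
        ∈-upTo⁺ (height<length u∈ (∈-filter-allFin Q? ∘ downward (Q-of u∈)))

-- The invariant of the induction. The first field keeps an element from being both lower and upper,
-- the second gives a basic element in any nonempty poset, and the third identifies the elements
-- that are left out of `P_g` for a new greatest element `g`.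
record WellBased (P : FinPoset) : Set where
  open FinPoset P
  field
    basics-antichain : ∀ {b c} → Basic P b → Basic P c → Comparable P b c → b ≡ c
    basic-exists     : Carrier → ∃[ b ] Basic P b
    universal        : ∀ {a} → (∀ b → Basic P b → Comparable P a b) → Universal P a

-- Chains

-- The contribution of the singleton at height `k` of a chain: only the minimum is basic, and its
-- `P_a` is empty.
chainMonomial : ℕ → ℕ × ℕ
chainMonomial zero    = 1 , 0
chainMonomial (suc k) = 0 , suc k

chainPoly : ℕ → Poly
chainPoly n = map chainMonomial (upTo n)

-- The hypothesis is guarded by `Fin n` because it fails for the empty poset, where `L` is `1ₚ` but
-- `chainPoly 0` is the empty sum.
extend-chainPoly : ∀ n {p} → (Fin n → p ↭ chainPoly n) → extend n p ↭ chainPoly (suc n)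
extend-chainPoly zero    _   = ↭-refl
extend-chainPoly (suc n) {p} eq = begin
  p ++ chainMonomial (suc n) ∷ []                     ↭⟨ ++⁺ʳ _ (eq zero) ⟩
  chainPoly (suc n) ++ map chainMonomial (suc n ∷ []) ≡⟨ map-++ chainMonomial (upTo (suc n)) _ ⟨
  map chainMonomial (upTo (suc n) ++ suc n ∷ [])      ≡⟨ cong (map chainMonomial) (upTo-∷ʳ (suc n)) ⟩
  chainPoly (suc (suc n))                             ∎
  where open PermutationReasoning

module _ (P : FinPoset) (chain : Chain P) where
  open FinPoset P
  open IsDecPartialOrder isDecPartialOrder using () renaming (trans to ≤-trans; antisym to ≤-antisym)

  chain-minimal⇒basic : ∀ {m} → (∀ {u} → ¬ _<_ P u m) → Basic P m
  chain-minimal⇒basic min =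
    (λ (_ , _ , inc , _) → inc (chain _ _)) , (λ (_ , _ , inc , _) → inc (chain _ _)) , λ (_ , u<m , _) → min u<m

  -- A non-minimal element of a chain violates (B.3) with its predecessor.
  chain-basic⇒minimal : ∀ {x} → Basic P x → ∀ {u} → ¬ _<_ P u x
  chain-basic⇒minimal {x} (_ , _ , b3) {u} u<x
    with maximum P (∈-filter-allFin (λ v → _<?_ P v x) u<x) (λ _ _ → chain _ _)
  ... | m , m∈ , ub = b3 (m , m<x , λ w w≢m w≢x →
      ((λ w≤m → ≤-trans w≤m (proj₁ m<x)) , (λ w≤x → below w≤x w≢x)) ,
      ((λ m≤w → [ id , (λ w≤x → contradiction (≤-antisym (below w≤x w≢x) m≤w) w≢m) ]′ (chain x w)) ,
       ≤-trans (proj₁ m<x)))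
    where
    m<x : _<_ P m x
    m<x = proj₂ (∈-filter⁻ (λ v → _<?_ P v x) {xs = allFin size} m∈)
    below : ∀ {w} → w ≤ x → w ≢ x → w ≤ m
    below w≤x w≢x = ub (∈-filter-allFin (λ v → _<?_ P v x) (w≤x , w≢x))

  -- The whole chain is a totally ordered down-set, cut out by the trivial predicate; the two inner
  -- rewritings remove the filter and the outer one evaluates the length.
  chain-map-height : map (height P) (allFin size) ↭ upTo size
  chain-map-height = subst (λ n → map (height P) (allFin size) ↭ upTo n) (length-allFin size)
    (subst (λ us → map (height P) us ↭ upTo (length us))
      (filter-all (λ _ → yes tt) (All.universal (λ _ → tt) (allFin size)))
      (map-height-↭ P {Q = λ _ → ⊤} (λ _ → yes tt) (λ _ _ → chain _ _) (λ _ _ → tt)))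

  -- The heights exhaust `upTo size`, so some element has height 0, and nothing can lie below it.
  chain-minimal-exists : Carrier → ∃[ m ] (∀ {u} → ¬ _<_ P u m)
  chain-minimal-exists x with ∈-map⁻ (height P)
    (∈-resp-↭ (↭-sym chain-map-height) (∈-upTo⁺ (ℕₚ.≤-<-trans z≤n (Finₚ.toℕ<n x))))
  ... | m , _ , 0≡h = m , λ u<m → ℕₚ.n≮0 (subst (_ ℕ.<_) (sym 0≡h) (height-strictMono P u<m))

  chain-wellBased : WellBased P
  chain-wellBased = record
    { basics-antichain = λ bas bas′ c → incomparable-below bas bas′ (comparable⇒≡⊎<⊎> P c)
    ; basic-exists     = λ x → let m , min = chain-minimal-exists x in m , chain-minimal⇒basic min
    ; universal        = λ _ → chain _
    }
    where
    incomparable-below : ∀ {b c} → Basic P b → Basic P c → b ≡ c ⊎ _<_ P b c ⊎ _<_ P c b → b ≡ c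
    incomparable-below _ _    (inj₁ eq)         = eq
    incomparable-below _ bas′ (inj₂ (inj₁ b<c)) = contradiction b<c (chain-basic⇒minimal bas′)
    incomparable-below bas _  (inj₂ (inj₂ c<b)) = contradiction c<b (chain-basic⇒minimal bas)

  -- The witness `u` makes `a` non-minimal, hence upper. As the minimum is the only basic element,
  -- no element is lower, and none is incomparable to `a`, so `P_a` is everything below `a`.
  chain-∣P∣ : ∀ {a u} → _<_ P u a → ∣P∣ P a ≡ height P a
  chain-∣P∣ {a} {u} u<a =
    length-filter-allFin (λ v → _<?_ P v a) (inP? P a) id <⇒inP (λ v∈P → _ , refl , inP⇒< v∈P)
    where
    inP⇒< : ∀ {v} → InP P a v → _<_ P v a
    inP⇒< (inj₁ ((_ , _ , bas , a<b) , _)) = contradiction a<b (chain-basic⇒minimal bas)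
    inP⇒< (inj₂ (_ , v<a , _)) = v<a
    m<a : ∀ {m} → (∀ {v} → ¬ _<_ P v m) → _<_ P m a
    m<a {m} min with comparable⇒≡⊎<⊎> P (chain m a)
    ... | inj₁ refl       = contradiction u<a min
    ... | inj₂ (inj₁ m<a) = m<a
    ... | inj₂ (inj₂ a<m) = contradiction a<m min
    <⇒inP : ∀ {v} → _<_ P v a → InP P a v
    <⇒inP v<a with m , min ← chain-minimal-exists a = inj₂
      (((λ bas → chain-basic⇒minimal bas u<a) , m , chain-minimal⇒basic min , m<a min) , v<a ,
       (λ (_ , _ , inc) → inc (chain _ _)) , λ ((_ , _ , bas , v<b) , _) → chain-basic⇒minimal bas v<b)

  chain-weight : ∀ a → weight P ⁅ a ⁆ ≡ chainMonomial (height P a)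
  chain-weight a with any? (λ u → _<?_ P u a)
  ... | yes (u , u<a) = trans (weight-singleton-nonbasic P (λ bas → chain-basic⇒minimal bas u<a))
    (trans (cong (0 ,_) (chain-∣P∣ u<a)) (positive (ℕₚ.≤-<-trans z≤n (height-strictMono P u<a))))
    where
    positive : ∀ {k} → 0 ℕ.< k → (0 , k) ≡ chainMonomial k
    positive (s≤s _) = refl
  ... | no min = trans (weight-singleton-basic P bas)
    (trans (cong ((1 ,_) ∘ length) (filter-none (inP? P a) (All.universal (λ _ → notInP) (allFin size))))
      (cong (chainMonomial ∘ length) (sym (filter-none (λ v → _<?_ P v a) (All.universal (λ u u<a → min (u , u<a)) (allFin size))))))
    where
    bas : Basic P a
    bas = chain-minimal⇒basic (λ u<a → min (_ , u<a))
    notInP : ∀ {v} → ¬ InP P a v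
    notInP (inj₁ ((¬bas , _) , _)) = ¬bas bas
    notInP (inj₂ ((¬bas , _) , _)) = ¬bas bas

  -- The argument `x` excludes the empty poset. Domination of `x` gives each maximal antichain a
  -- member, and in a chain that member is all of it.
  L-chain : Carrier → L P ↭ chainPoly size
  L-chain x = begin
    map (weight P) (𝒜 P)                          ↭⟨ map⁺ (weight P) 𝒜-singletons ⟩
    map (weight P) (map ⁅_⁆ (allFin size))        ≡⟨ map-∘ (allFin size) ⟨
    map (weight P ∘ ⁅_⁆) (allFin size)            ≡⟨ map-cong chain-weight (allFin size) ⟩
    map (chainMonomial ∘ height P) (allFin size)  ≡⟨ map-∘ (allFin size) ⟩
    map chainMonomial (map (height P) (allFin size)) ↭⟨ map⁺ chainMonomial chain-map-height ⟩
    chainPoly size                                ∎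
    where
    open PermutationReasoning
    𝒜-singletons : 𝒜 P ↭ map ⁅_⁆ (allFin size)
    𝒜-singletons = ↭-of-unique (𝒜-unique P) (Unique.map⁺ ⁅⁆-injective (Unique.allFin⁺ size))
      (λ A∈ → let anti , dom = ∈𝒜⁻ P A∈ ; a , a∈A , _ = dom x in
        subst (_∈ₗ map ⁅_⁆ (allFin size)) (sym (antichain∋universal P anti a∈A (chain a))) (∈-map⁺ ⁅_⁆ (∈-allFin a)))
      (λ A∈ → let a , _ , eq = ∈-map⁻ ⁅_⁆ A∈ in subst (_∈ₗ 𝒜 P) (sym eq) (singleton∈𝒜 P (chain a)))

-- Extending a poset

module _ (P R : FinPoset) (i : FinPoset.Carrier P → FinPoset.Carrier R) where
  private
    module P = FinPoset P
    module R = FinPoset R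

  -- An element outside i(P) but comparable to it is required to be universal and
  -- non-basic; this makes Basic, Lower, Upper and P_a agree on P and on i(P).
  data Position (r : R.Carrier) : Set where
    inside : ∀ p → r ≡ i p → Position r
    apart  : (∀ p → Incomparable R r (i p)) → Position r
    above  : (∀ p → _<_ R (i p) r) → Universal R r → ¬ Basic R r → Position r
    below  : (∀ p → _<_ R r (i p)) → Universal R r → ¬ Basic R r → ¬ Chain P → Position r

  record IsEmbedding : Set where
    field
      mono   : ∀ {p q} → p P.≤ q → i p R.≤ i q
      cancel : ∀ {p q} → i p R.≤ i q → p P.≤ q

    injective : ∀ {p q} → i p ≡ i q → p ≡ q
    injective {p} eq = ≤ₚ-antisym (cancel (subst (i p R.≤_) eq ≤-refl)) (cancel (subst (R._≤ i p) eq ≤-refl))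
      where
      open IsDecPartialOrder R.isDecPartialOrder using () renaming (refl to ≤-refl)
      open IsDecPartialOrder P.isDecPartialOrder using () renaming (antisym to ≤ₚ-antisym)

    comparable⁺ : ∀ {p q} → Comparable P p q → Comparable R (i p) (i q)
    comparable⁺ = [ inj₁ ∘ mono , inj₂ ∘ mono ]′

    comparable⁻ : ∀ {p q} → Comparable R (i p) (i q) → Comparable P p q
    comparable⁻ = [ inj₁ ∘ cancel , inj₂ ∘ cancel ]′

  record IsExtension : Set where
    field
      isEmbedding : IsEmbedding
      position    : ∀ r → Position r
    open IsEmbedding isEmbedding public

-- Transfer of basic elements and of the sets `P_a` along an extension.

module Extension {P R : FinPoset} {i : FinPoset.Carrier P → FinPoset.Carrier R} (ext : IsExtension P R i) where
  private
    module P = FinPoset P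
    module R = FinPoset R
  open IsExtension ext public

  <⁺ : ∀ {p q} → _<_ P p q → _<_ R (i p) (i q)
  <⁺ (le , ne) = mono le , ne ∘ injective

  <⁻ : ∀ {p q} → _<_ R (i p) (i q) → _<_ P p q
  <⁻ (le , ne) = cancel le , ne ∘ cong i

  data Under (r : R.Carrier) : Set where
    inside : ∀ p → r ≡ i p → Under r
    below  : (∀ p → _<_ R r (i p)) → Universal R r → ¬ Chain P → Under r

  under : ∀ {r p} → r R.≤ i p → Under r
  under {r} {p} le with position r
  ... | inside q eq     = inside q eq
  ... | apart inc       = contradiction (inj₁ le) (inc p)
  ... | above gt _ _    = contradiction le (<-irrefl R (gt p))
  ... | below lt univ _ ¬chain = below lt univ ¬chain

  data Over (r : R.Carrier) : Set where
    inside : ∀ p → r ≡ i p → Over r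
    above  : Universal R r → Over r

  over : ∀ {r p} → i p R.≤ r → Over r
  over {r} {p} le with position r
  ... | inside q eq    = inside q eq
  ... | apart inc      = contradiction (inj₂ le) (inc p)
  ... | above _ univ _ = above univ
  ... | below lt _ _ _ = contradiction le (<-irrefl R (lt p))

  -- The clause on `u` in (B.3), stated for any poset so that it can be moved between `P` and `R`.
  Twins : (S : FinPoset) → FinPoset.Carrier S → FinPoset.Carrier S → Set
  Twins S u x = ∀ w → w ≢ u → w ≢ x →
    ((w S.≤ u → w S.≤ x) × (w S.≤ x → w S.≤ u)) × ((u S.≤ w → x S.≤ w) × (x S.≤ w → u S.≤ w))
    where module S = FinPoset S

  twins⁻ : ∀ {p q} → Twins R (i p) (i q) → Twins P p q
  twins⁻ tw w w≢p w≢q with tw (i w) (w≢p ∘ injective) (w≢q ∘ injective)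
  ... | (a , b) , (c , d) = (cancel ∘ a ∘ mono , cancel ∘ b ∘ mono) , (cancel ∘ c ∘ mono , cancel ∘ d ∘ mono)

  -- An outside element has the same order relation to all of `i(P)`, so it cannot tell `i p` from
  -- `i q`.
  twins⁺ : ∀ {p q} → Twins P p q → Twins R (i p) (i q)
  twins⁺ {p} {q} tw w w≢p w≢q with position w
  ... | inside w′ refl with tw w′ (w≢p ∘ cong i) (w≢q ∘ cong i)
  ...   | (a , b) , (c , d) = (mono ∘ a ∘ cancel , mono ∘ b ∘ cancel) , (mono ∘ c ∘ cancel , mono ∘ d ∘ cancel)
  twins⁺ {p} {q} tw w _ _ | apart inc =
    ((λ le → contradiction (inj₁ le) (inc p)) , (λ le → contradiction (inj₁ le) (inc q))) ,
    ((λ le → contradiction (inj₂ le) (inc p)) , (λ le → contradiction (inj₂ le) (inc q)))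
  twins⁺ {p} {q} tw w _ _ | above gt _ _ =
    ((λ le → contradiction le (<-irrefl R (gt p))) , (λ le → contradiction le (<-irrefl R (gt q)))) ,
    ((λ _ → proj₁ (gt q)) , (λ _ → proj₁ (gt p)))
  twins⁺ {p} {q} tw w _ _ | below lt _ _ _ =
    ((λ _ → proj₁ (lt q)) , (λ _ → proj₁ (lt p))) ,
    ((λ le → contradiction le (<-irrefl R (lt p))) , (λ le → contradiction le (<-irrefl R (lt q))))

  basic⁻ : ∀ {p} → Basic R (i p) → Basic P p
  basic⁻ (b1 , b2 , b3) =
    (λ (u , v , inc , u< , v<) → b1 (i u , i v , inc ∘ comparable⁻ , <⁺ u< , <⁺ v<)) ,
    (λ (u , v , inc , u< , v<) → b2 (i u , i v , inc ∘ comparable⁻ , <⁺ u< , <⁺ v<)) ,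
    (λ (u , u< , tw) → b3 (i u , <⁺ u< , twins⁺ tw))

  -- Outside elements comparable to `i p` are universal, so a pair violating (B.1) or (B.2) at `i p`
  -- lies inside `i(P)`.
  basic⁺ : ∀ {p} → Basic P p → Basic R (i p)
  basic⁺ {p} (b1 , b2 , b3) = b1′ , b2′ , b3′
    where
    b1′ : B1 R (i p)
    b1′ (u , v , inc , u< , v<) with under (proj₁ u<) | under (proj₁ v<)
    ... | below _ univ _ | _              = inc (univ v)
    ... | inside _ refl  | below _ univ _ = inc (comparable-sym R (univ _))
    ... | inside u′ refl | inside v′ refl = b1 (u′ , v′ , inc ∘ comparable⁺ , <⁻ u< , <⁻ v<)

    b2′ : B2 R (i p)
    b2′ (u , v , inc , u< , v<) with over (proj₁ u<) | over (proj₁ v<)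
    ... | above univ     | _              = inc (univ v)
    ... | inside _ refl  | above univ     = inc (comparable-sym R (univ _))
    ... | inside u′ refl | inside v′ refl = b2 (u′ , v′ , inc ∘ comparable⁺ , <⁻ u< , <⁻ v<)

    -- A twin of i p below all of i(P) makes p the minimum of P, and then P is a chain by (B.2).
    b3′ : B3 R (i p)
    b3′ (u , u< , tw) with under (proj₁ u<)
    ... | inside u′ refl    = b3 (u′ , <⁻ u< , twins⁻ tw)
    ... | below lt _ ¬chain = ¬chain chain
      where
      p≤ : ∀ {w} → w ≢ p → _<_ P p w
      p≤ {w} w≢p = cancel (proj₁ (proj₂ (tw (i w) (proj₂ (lt w) ∘ sym) (w≢p ∘ injective))) (proj₁ (lt w))) , w≢p ∘ sym
      chain : Chain P
      chain v w with v ≟ p | w ≟ p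
      ... | no v≢p   | no w≢p   = ¬incomparable P λ inc → b2 (v , w , inc , p≤ v≢p , p≤ w≢p)
      ... | no v≢p   | yes refl = inj₂ (proj₁ (p≤ v≢p))
      ... | yes refl | no w≢p   = inj₁ (proj₁ (p≤ w≢p))
      ... | yes refl | yes refl = comparable-refl P

  -- Outside elements are non-basic or apart from all of `i(P)`. Hence the basic elements that
  -- decide whether `i p` is lower or upper, and what it is associated to, all come from `P`.
  basic-inside : ∀ {p r} → Basic R r → Comparable R (i p) r → ∃[ q ] r ≡ i q
  basic-inside {p} {r} bas c with position r
  ... | inside q eq     = q , eq
  ... | apart inc       = contradiction (comparable-sym R c) (inc p)
  ... | above _ _ ¬bas  = contradiction bas ¬bas
  ... | below _ _ ¬bas _ = contradiction bas ¬bas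

  lower⁺ : ∀ {p} → Lower P p → Lower R (i p)
  lower⁺ (¬bas , b , bas , p<b) = ¬bas ∘ basic⁻ , i b , basic⁺ bas , <⁺ p<b

  lower⁻ : ∀ {p} → Lower R (i p) → Lower P p
  lower⁻ (¬bas , b , bas , p<b) with b′ , refl ← basic-inside bas (inj₁ (proj₁ p<b)) =
    ¬bas ∘ basic⁺ , b′ , basic⁻ bas , <⁻ p<b

  upper⁺ : ∀ {p} → Upper P p → Upper R (i p)
  upper⁺ (¬bas , b , bas , b<p) = ¬bas ∘ basic⁻ , i b , basic⁺ bas , <⁺ b<p

  upper⁻ : ∀ {p} → Upper R (i p) → Upper P p
  upper⁻ (¬bas , b , bas , b<p) with b′ , refl ← basic-inside bas (inj₂ (proj₁ b<p)) =
    ¬bas ∘ basic⁺ , b′ , basic⁻ bas , <⁻ b<p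

  associated⁺ : ∀ {p q} → AssociatedTo P q (BasicsOf P p) → AssociatedTo R (i q) (BasicsOf R (i p))
  associated⁺ {p} {q} (comp , inc) = comp′ , inc′
    where
    comp′ : ∀ b → BasicsOf R (i p) b → Comparable R (i q) b
    comp′ b (bas , c) with b′ , refl ← basic-inside bas c = comparable⁺ (comp b′ (basic⁻ bas , comparable⁻ c))
    inc′ : ∀ b → Basic R b → ¬ BasicsOf R (i p) b → Incomparable R (i q) b
    inc′ b bas ¬B c with b′ , refl ← basic-inside bas c =
      inc b′ (basic⁻ bas) (λ (_ , c′) → ¬B (bas , comparable⁺ c′)) (comparable⁻ c)

  associated⁻ : ∀ {p q} → AssociatedTo R (i q) (BasicsOf R (i p)) → AssociatedTo P q (BasicsOf P p)
  associated⁻ (comp , inc) =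
    (λ b (bas , c) → comparable⁻ (comp (i b) (basic⁺ bas , comparable⁺ c))) ,
    (λ b bas ¬B c → inc (i b) (basic⁺ bas) (λ (_ , c′) → ¬B (bas , comparable⁻ c′)) (comparable⁺ c))

  -- A forbidden `c` in `R` would be comparable to `i q` but incomparable to `i p`. An outside
  -- element is universal or apart from `i(P)`, so such a `c` comes from `P`.
  inP⁺ : ∀ {p q} → InP P p q → InP R (i p) (i q)
  inP⁺ {p} {q} (inj₁ (low , p<q , none)) = inj₁ (lower⁺ low , <⁺ p<q , none′)
    where
    none′ : ¬ (∃[ c ] _<_ R c (i q) × Incomparable R c (i p))
    none′ (c , c<q , inc) with under (proj₁ c<q)
    ... | inside c′ refl = none (c′ , <⁻ c<q , inc ∘ comparable⁺)
    ... | below _ univ _ = inc (univ (i p))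
  inP⁺ {p} {q} (inj₂ (up , q<p , none , ¬low)) =
    inj₂ (upper⁺ up , <⁺ q<p , none′ , λ (low , ass) → ¬low (lower⁻ low , associated⁻ ass))
    where
    none′ : ¬ (∃[ c ] _<_ R (i q) c × Incomparable R c (i p))
    none′ (c , q<c , inc) with over (proj₁ q<c)
    ... | inside c′ refl = none (c′ , <⁻ q<c , inc ∘ comparable⁺)
    ... | above univ     = inc (univ (i p))

  inP⁻ : ∀ {p q} → InP R (i p) (i q) → InP P p q
  inP⁻ (inj₁ (low , p<q , none)) =
    inj₁ (lower⁻ low , <⁻ p<q , λ (c , c<q , inc) → none (i c , <⁺ c<q , inc ∘ comparable⁻))
  inP⁻ (inj₂ (up , q<p , none , ¬low)) =
    inj₂ (upper⁻ up , <⁻ q<p , (λ (c , q<c , inc) → none (i c , <⁺ q<c , inc ∘ comparable⁻)) ,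
          λ (low , ass) → ¬low (lower⁺ low , associated⁺ ass))

  inP-comparable : ∀ {a r} → InP R a r → Comparable R a r
  inP-comparable (inj₁ (_ , a<r , _)) = inj₁ (proj₁ a<r)
  inP-comparable (inj₂ (_ , r<a , _)) = inj₂ (proj₁ r<a)

  -- Subsets and their monomials along an extension.

  private
    InImage : Subset P.size → R.Carrier → Set
    InImage A r = ∃[ p ] p ∈ A × r ≡ i p

    inImage? : ∀ A → Decidable (InImage A)
    inImage? A r = any? λ p → (p ∈? A) ×-dec (r ≟ i p)

  image : Subset P.size → Subset R.size
  image A = comprehension (inImage? A)

  ∈-image⁺ : ∀ {A p} → p ∈ A → i p ∈ image A
  ∈-image⁺ {A} p∈A = ∈-comprehension⁺ (inImage? A) (_ , p∈A , refl)

  ∈-image⁻ : ∀ {A r} → r ∈ image A → ∃[ p ] p ∈ A × r ≡ i p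
  ∈-image⁻ {A} = ∈-comprehension⁻ (inImage? A)

  ∈-image-inside : ∀ {A p} → i p ∈ image A → p ∈ A
  ∈-image-inside {A} ip∈ with q , q∈ , eq ← ∈-image⁻ ip∈ = subst (_∈ A) (sym (injective eq)) q∈

  preimage : Subset R.size → Subset P.size
  preimage A = comprehension (λ p → i p ∈? A)

  ∈-preimage⁺ : ∀ {A p} → i p ∈ A → p ∈ preimage A
  ∈-preimage⁺ {A} = ∈-comprehension⁺ (λ p → i p ∈? A)

  ∈-preimage⁻ : ∀ {A p} → p ∈ preimage A → i p ∈ A
  ∈-preimage⁻ {A} = ∈-comprehension⁻ (λ p → i p ∈? A)

  image-injective : ∀ {A B} → image A ≡ image B → A ≡ B
  image-injective eq = ⊆-antisym
    (λ p∈ → ∈-image-inside (subst (_ ∈_) eq (∈-image⁺ p∈)))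
    (λ p∈ → ∈-image-inside (subst (_ ∈_) (sym eq) (∈-image⁺ p∈)))

  antichain-preimage : ∀ {A} → Antichain R A → Antichain P (preimage A)
  antichain-preimage anti p q p∈ q∈ p≢q =
    anti (i p) (i q) (∈-preimage⁻ p∈) (∈-preimage⁻ q∈) (p≢q ∘ injective) ∘ comparable⁺

  antichain-image : ∀ {A} → Antichain P A → Antichain R (image A)
  antichain-image anti u v u∈ v∈ u≢v with ∈-image⁻ u∈ | ∈-image⁻ v∈
  ... | p , p∈ , refl | q , q∈ , refl = anti p q p∈ q∈ (u≢v ∘ cong i) ∘ comparable⁻

  elements-image : ∀ A → elements R (image A) ↭ map i (elements P A)
  elements-image A = filter-allFin-↭-map (_∈? A) (_∈? image A) injective ∈-image⁺
    λ r∈ → let p , p∈ , eq = ∈-image⁻ r∈ in p , eq , p∈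

  filter-basic-map : ∀ ps → length (filter (basic? R) (map i ps)) ≡ length (filter (basic? P) ps)
  filter-basic-map ps = trans (cong length (filter-map (basic? P) (basic? R) basic⁺ basic⁻ ps))
    (length-map i (filter (basic? P) ps))

  sum-∣P∣-map : ∀ {ps} → (∀ {p} → p ∈ₗ ps → ∣P∣ R (i p) ≡ ∣P∣ P p) →
                sum (map (∣P∣ R) (map i ps)) ≡ sum (map (∣P∣ P) ps)
  sum-∣P∣-map {ps} eq = cong sum (trans (sym (map-∘ ps)) (map-cong-local (All.tabulate eq)))

  -- The number of basic elements carries over by itself, so only the sets `P_a` with `a` in `A`
  -- need control; a new greatest element enlarges some of the others.
  weight-image : ∀ {A} → (∀ {p} → p ∈ A → ∣P∣ R (i p) ≡ ∣P∣ P p) → weight R (image A) ≡ weight P A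
  weight-image {A} eq = cong₂ _,_
    (trans (↭-length (filter-↭ (basic? R) (elements-image A))) (filter-basic-map (elements P A)))
    (trans (sum-↭ (map⁺ (∣P∣ R) (elements-image A))) (sum-∣P∣-map (eq ∘ ∈-elements⁻ P)))

  ∣P∣-inside : ∀ {p} → (∀ {r} → InP R (i p) r → ∃[ q ] r ≡ i q) → ∣P∣ R (i p) ≡ ∣P∣ P p
  ∣P∣-inside {p} ins = length-filter-allFin (inP? P p) (inP? R (i p)) injective inP⁺ to
    where
    to : ∀ {r} → InP R (i p) r → ∃[ q ] r ≡ i q × InP P p q
    to r∈P with q , refl ← ins r∈P = q , refl , inP⁻ r∈P

  ∣P∣-inside-suc : ∀ {p z} → (∀ q → z ≢ i q) → InP R (i p) z →
                   (∀ r → r ≡ z ⊎ ∃[ q ] r ≡ i q) → ∣P∣ R (i p) ≡ suc (∣P∣ P p)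
  ∣P∣-inside-suc {p} {z} z≢ z∈P cover = trans
    (↭-length (filter-allFin-↭-∷map (inP? P p) (inP? R (i p)) injective inP⁺ z∈P z≢ to))
    (cong suc (length-map i (filter (inP? P p) (allFin P.size))))
    where
    to : ∀ {r} → InP R (i p) r → r ≡ z ⊎ (∃[ q ] r ≡ i q × InP P p q)
    to {r} r∈P with cover r
    ... | inj₁ r≡z        = inj₁ r≡z
    ... | inj₂ (q , refl) = inj₂ (q , refl , inP⁻ r∈P)

-- Disjoint unions

module Union {P Q R : FinPoset} {i : FinPoset.Carrier P → FinPoset.Carrier R}
             {j : FinPoset.Carrier Q → FinPoset.Carrier R}
             (extᵢ : IsExtension P R i) (extⱼ : IsExtension Q R j)
             (cover : ∀ r → (∃[ p ] r ≡ i p) ⊎ (∃[ q ] r ≡ j q))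
             (disjoint : ∀ p q → Incomparable R (i p) (j q)) where
  private
    module P = FinPoset P
    module Q = FinPoset Q
    module R = FinPoset R
    module I = Extension extᵢ
    module J = Extension extⱼ

  i≢j : ∀ {p q} → i p ≢ j q
  i≢j {p} {q} eq = disjoint p q (subst (Comparable R (i p)) eq (comparable-refl R))

  union-wellBased : WellBased P → WellBased Q → WellBased R
  union-wellBased wP wQ = record { basics-antichain = anti ; basic-exists = exists ; universal = univ }
    where
    module wP = WellBased wP
    module wQ = WellBased wQ
    anti : ∀ {b c} → Basic R b → Basic R c → Comparable R b c → b ≡ c
    anti {b} {c} bas bas′ cmp with cover b | cover c
    ... | inj₁ (p , refl) | inj₁ (p′ , refl) = cong i (wP.basics-antichain (I.basic⁻ bas) (I.basic⁻ bas′) (I.comparable⁻ cmp))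
    ... | inj₁ (p , refl) | inj₂ (q , refl)  = contradiction cmp (disjoint p q)
    ... | inj₂ (q , refl) | inj₁ (p , refl)  = contradiction (comparable-sym R cmp) (disjoint p q)
    ... | inj₂ (q , refl) | inj₂ (q′ , refl) = cong j (wQ.basics-antichain (J.basic⁻ bas) (J.basic⁻ bas′) (J.comparable⁻ cmp))
    exists : R.Carrier → ∃[ b ] Basic R b
    exists r with cover r
    ... | inj₁ (p , _) = let b , bas = wP.basic-exists p in i b , I.basic⁺ bas
    ... | inj₂ (q , _) = let b , bas = wQ.basic-exists q in j b , J.basic⁺ bas
    univ : ∀ {a} → (∀ b → Basic R b → Comparable R a b) → Universal R a
    univ {a} cmp r with cover a | cover r
    ... | inj₁ (p , refl) | inj₁ (p′ , refl) =
      I.comparable⁺ (wP.universal (λ b bas → I.comparable⁻ (cmp (i b) (I.basic⁺ bas))) p′)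
    -- The element `q` provides a basic element of `Q`, to which `i p` cannot be comparable, so this
    -- case is void.
    ... | inj₁ (p , refl) | inj₂ (q , refl) =
      let b , bas = wQ.basic-exists q in contradiction (cmp (j b) (J.basic⁺ bas)) (disjoint p b)
    ... | inj₂ (q , refl) | inj₁ (p , refl) =
      let b , bas = wP.basic-exists p in contradiction (comparable-sym R (cmp (i b) (I.basic⁺ bas))) (disjoint b q)
    ... | inj₂ (q , refl) | inj₂ (q′ , refl) =
      J.comparable⁺ (wQ.universal (λ b bas → J.comparable⁻ (cmp (j b) (J.basic⁺ bas))) q′)

  ∣P∣ᵢ : ∀ p → ∣P∣ R (i p) ≡ ∣P∣ P p
  ∣P∣ᵢ p = I.∣P∣-inside λ {r} r∈P → [ id , (λ where (q , refl) → contradiction (I.inP-comparable r∈P) (disjoint p q)) ]′ (cover r)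

  ∣P∣ⱼ : ∀ q → ∣P∣ R (j q) ≡ ∣P∣ Q q
  ∣P∣ⱼ q = J.∣P∣-inside λ {r} r∈P →
    [ (λ where (p , refl) → contradiction (comparable-sym R (J.inP-comparable r∈P)) (disjoint p q)) , id ]′ (cover r)

  combine : Subset P.size → Subset Q.size → Subset R.size
  combine A B = I.image A ∪ J.image B

  ∈-combineᵢ⁺ : ∀ {A B p} → p ∈ A → i p ∈ combine A B
  ∈-combineᵢ⁺ p∈ = x∈p∪q⁺ (inj₁ (I.∈-image⁺ p∈))

  ∈-combineⱼ⁺ : ∀ {A B q} → q ∈ B → j q ∈ combine A B
  ∈-combineⱼ⁺ q∈ = x∈p∪q⁺ (inj₂ (J.∈-image⁺ q∈))

  ∈-combine⁻ : ∀ {A B r} → r ∈ combine A B → (∃[ p ] p ∈ A × r ≡ i p) ⊎ (∃[ q ] q ∈ B × r ≡ j q)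
  ∈-combine⁻ {A} {B} r∈ with x∈p∪q⁻ (I.image A) (J.image B) r∈
  ... | inj₁ r∈i = inj₁ (I.∈-image⁻ r∈i)
  ... | inj₂ r∈j = inj₂ (J.∈-image⁻ r∈j)

  ∈-combineᵢ⁻ : ∀ {A B p} → i p ∈ combine A B → p ∈ A
  ∈-combineᵢ⁻ {A} {B} p∈ with ∈-combine⁻ {A} {B} p∈
  ... | inj₁ (p′ , p′∈ , eq) = subst (_∈ A) (sym (I.injective eq)) p′∈
  ... | inj₂ (q , _ , eq)    = contradiction eq i≢j

  ∈-combineⱼ⁻ : ∀ {A B q} → j q ∈ combine A B → q ∈ B
  ∈-combineⱼ⁻ {A} {B} q∈ with ∈-combine⁻ {A} {B} q∈
  ... | inj₁ (p , _ , eq)    = contradiction (sym eq) i≢j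
  ... | inj₂ (q′ , q′∈ , eq) = subst (_∈ B) (sym (J.injective eq)) q′∈

  combine-injective : ∀ {A A′ B B′} → combine A B ≡ combine A′ B′ → A ≡ A′ × B ≡ B′
  combine-injective eq =
    ⊆-antisym (λ p∈ → ∈-combineᵢ⁻ (subst (_ ∈_) eq (∈-combineᵢ⁺ p∈)))
              (λ p∈ → ∈-combineᵢ⁻ (subst (_ ∈_) (sym eq) (∈-combineᵢ⁺ p∈))) ,
    ⊆-antisym (λ q∈ → ∈-combineⱼ⁻ (subst (_ ∈_) eq (∈-combineⱼ⁺ q∈)))
              (λ q∈ → ∈-combineⱼ⁻ (subst (_ ∈_) (sym eq) (∈-combineⱼ⁺ q∈)))

  combine-preimages : ∀ A → A ≡ combine (I.preimage A) (J.preimage A)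
  combine-preimages A = ⊆-antisym to from
    where
    to : ∀ {r} → r ∈ A → r ∈ combine (I.preimage A) (J.preimage A)
    to {r} r∈ with cover r
    ... | inj₁ (p , refl) = ∈-combineᵢ⁺ (I.∈-preimage⁺ r∈)
    ... | inj₂ (q , refl) = ∈-combineⱼ⁺ (J.∈-preimage⁺ r∈)
    from : ∀ {r} → r ∈ combine (I.preimage A) (J.preimage A) → r ∈ A
    from r∈ with ∈-combine⁻ {I.preimage A} r∈
    ... | inj₁ (p , p∈ , refl) = I.∈-preimage⁻ p∈
    ... | inj₂ (q , q∈ , refl) = J.∈-preimage⁻ q∈

  combine-antichain : ∀ {A B} → Antichain P A → Antichain Q B → Antichain R (combine A B)
  combine-antichain {A} {B} antiA antiB u v u∈ v∈ u≢v c with ∈-combine⁻ {A} {B} u∈ | ∈-combine⁻ {A} {B} v∈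
  ... | inj₁ (p , p∈ , refl) | inj₁ (p′ , p′∈ , refl) = antiA p p′ p∈ p′∈ (u≢v ∘ cong i) (I.comparable⁻ c)
  ... | inj₁ (p , _ , refl)  | inj₂ (q , _ , refl)    = disjoint p q c
  ... | inj₂ (q , _ , refl)  | inj₁ (p , _ , refl)    = disjoint p q (comparable-sym R c)
  ... | inj₂ (q , q∈ , refl) | inj₂ (q′ , q′∈ , refl) = antiB q q′ q∈ q′∈ (u≢v ∘ cong j) (J.comparable⁻ c)

  combine-dominating : ∀ {A B} → Dominating P A → Dominating Q B → Dominating R (combine A B)
  combine-dominating domA domB r with cover r
  ... | inj₁ (p , refl) = let a , a∈ , c = domA p in i a , ∈-combineᵢ⁺ a∈ , I.comparable⁺ c
  ... | inj₂ (q , refl) = let a , a∈ , c = domB q in j a , ∈-combineⱼ⁺ a∈ , J.comparable⁺ c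

  -- A member of `A` comparable to `i p` cannot come from `Q`; so maximality is tested in each part
  -- separately.
  preimageᵢ-dominating : ∀ {A} → Dominating R A → Dominating P (I.preimage A)
  preimageᵢ-dominating dom p with dom (i p)
  ... | a , a∈ , c with cover a
  ...   | inj₁ (p′ , refl) = p′ , I.∈-preimage⁺ a∈ , I.comparable⁻ c
  ...   | inj₂ (q , refl)  = contradiction (comparable-sym R c) (disjoint p q)

  preimageⱼ-dominating : ∀ {A} → Dominating R A → Dominating Q (J.preimage A)
  preimageⱼ-dominating dom q with dom (j q)
  ... | a , a∈ , c with cover a
  ...   | inj₁ (p , refl)  = contradiction c (disjoint p q)
  ...   | inj₂ (q′ , refl) = q′ , J.∈-preimage⁺ a∈ , J.comparable⁻ c

  𝒜-union : 𝒜 R ↭ cartesianProductWith combine (𝒜 P) (𝒜 Q)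
  𝒜-union = ↭-of-unique (𝒜-unique R)
    (Unique.cartesianProductWith⁺ combine combine-injective (𝒜-unique P) (𝒜-unique Q)) to from
    where
    to : ∀ {A} → A ∈ₗ 𝒜 R → A ∈ₗ cartesianProductWith combine (𝒜 P) (𝒜 Q)
    to {A} A∈ with anti , dom ← ∈𝒜⁻ R A∈ =
      subst (_∈ₗ cartesianProductWith combine (𝒜 P) (𝒜 Q)) (sym (combine-preimages A))
        (∈-cartesianProductWith⁺ combine
          (∈𝒜⁺ P (I.antichain-preimage anti) (preimageᵢ-dominating dom))
          (∈𝒜⁺ Q (J.antichain-preimage anti) (preimageⱼ-dominating dom)))
    from : ∀ {A} → A ∈ₗ cartesianProductWith combine (𝒜 P) (𝒜 Q) → A ∈ₗ 𝒜 R
    from A∈ with A , B , A∈P , B∈Q , refl ← ∈-cartesianProductWith⁻ combine (𝒜 P) (𝒜 Q) A∈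
      with antiA , domA ← ∈𝒜⁻ P A∈P | antiB , domB ← ∈𝒜⁻ Q B∈Q =
      ∈𝒜⁺ R (combine-antichain antiA antiB) (combine-dominating domA domB)

  elements-combine : ∀ A B → elements R (combine A B) ↭ map i (elements P A) ++ map j (elements Q B)
  elements-combine A B = ↭-of-unique (elements-unique R _)
    (Unique.++⁺ (Unique.map⁺ I.injective (elements-unique P A)) (Unique.map⁺ J.injective (elements-unique Q B))
      λ (p , q) → let _ , _ , eq = ∈-map⁻ i p ; _ , _ , eq′ = ∈-map⁻ j q in i≢j (trans (sym eq) eq′))
    to from
    where
    to : ∀ {r} → r ∈ₗ elements R (combine A B) → r ∈ₗ map i (elements P A) ++ map j (elements Q B)
    to r∈ with ∈-combine⁻ {A} {B} (∈-elements⁻ R r∈)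
    ... | inj₁ (p , p∈ , refl) = ∈-++⁺ˡ (∈-map⁺ i (∈-elements⁺ P p∈))
    ... | inj₂ (q , q∈ , refl) = ∈-++⁺ʳ (map i (elements P A)) (∈-map⁺ j (∈-elements⁺ Q q∈))
    from : ∀ {r} → r ∈ₗ map i (elements P A) ++ map j (elements Q B) → r ∈ₗ elements R (combine A B)
    from r∈ with ∈-++⁻ (map i (elements P A)) r∈
    ... | inj₁ r∈i with p , p∈ , refl ← ∈-map⁻ i r∈i = ∈-elements⁺ R (∈-combineᵢ⁺ (∈-elements⁻ P p∈))
    ... | inj₂ r∈j with q , q∈ , refl ← ∈-map⁻ j r∈j = ∈-elements⁺ R (∈-combineⱼ⁺ (∈-elements⁻ Q q∈))

  weight-combine : ∀ A B → weight R (combine A B) ≡ (b P A + b Q B , s P A + s Q B)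
  weight-combine A B = cong₂ _,_
    (trans (↭-length (filter-↭ (basic? R) (elements-combine A B)))
      (trans (cong length (filter-++ (basic? R) (map i (elements P A)) _))
        (trans (length-++ (filter (basic? R) (map i (elements P A))))
          (cong₂ _+_ (I.filter-basic-map (elements P A)) (J.filter-basic-map (elements Q B))))))
    (trans (sum-↭ (map⁺ (∣P∣ R) (elements-combine A B)))
      (trans (cong sum (map-++ (∣P∣ R) (map i (elements P A)) _))
        (trans (sum-++ (map (∣P∣ R) (map i (elements P A))) _)
          (cong₂ _+_ (I.sum-∣P∣-map {elements P A} (λ {p} _ → ∣P∣ᵢ p)) (J.sum-∣P∣-map {elements Q B} (λ {q} _ → ∣P∣ⱼ q))))))

  -- On a combined antichain both exponents add up, which is the product of monomials in `⊗`.
  L-union : L R ↭ L P ⊗ L Q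
  L-union = ↭-trans (map⁺ (weight R) 𝒜-union)
    (↭-reflexive (map-cartesianProductWith weight-combine (𝒜 P) (𝒜 Q)))

-- Adding an element comparable to all others

module OnePoint {P R : FinPoset} {i : FinPoset.Carrier P → FinPoset.Carrier R} {z : FinPoset.Carrier R}
                (emb : IsEmbedding P R i) (cover : ∀ r → r ≡ z ⊎ ∃[ p ] r ≡ i p)
                (z≢i : ∀ p → z ≢ i p) (z-universal : Universal R z) where
  private
    module P = FinPoset P
    module R = FinPoset R

  size-suc : R.size ≡ suc P.size
  size-suc = trans (sym (length-allFin R.size)) (trans (↭-length allFin-↭)
    (cong suc (trans (length-map i (allFin P.size)) (length-allFin P.size))))
    where
    to : ∀ {r} → r ∈ₗ allFin R.size → r ∈ₗ z ∷ map i (allFin P.size)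
    to {r} _ with cover r
    ... | inj₁ refl       = here refl
    ... | inj₂ (p , refl) = there (∈-map⁺ i (∈-allFin p))
    allFin-↭ : allFin R.size ↭ z ∷ map i (allFin P.size)
    allFin-↭ = ↭-of-unique (Unique.allFin⁺ R.size)
      (All.tabulate (λ r∈ z≡r → let p , _ , eq = ∈-map⁻ i r∈ in z≢i p (trans z≡r eq)) ∷
       Unique.map⁺ (IsEmbedding.injective emb) (Unique.allFin⁺ P.size))
      to (λ _ → ∈-allFin _)

  universal⁺ : ∀ {p} → Universal P p → Universal R (i p)
  universal⁺ {p} univ r with cover r
  ... | inj₁ refl       = comparable-sym R (z-universal (i p))
  ... | inj₂ (q , refl) = IsEmbedding.comparable⁺ emb (univ q)

  chain⁺ : Chain P → Chain R
  chain⁺ chain u with cover u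
  ... | inj₁ refl       = z-universal
  ... | inj₂ (p , refl) = universal⁺ (chain p)

  -- A chain with a new extremum is a chain again, so both sides are `chainPoly` at the same size.
  L-chain-extend : Chain P → ∀ {p} → p ↭ L P → extend P.size p ↭ L R
  L-chain-extend chain p↭ = ↭-trans
    (extend-chainPoly P.size (λ x → ↭-trans p↭ (L-chain P chain x)))
    (↭-trans (↭-reflexive (cong chainPoly (sym size-suc))) (↭-sym (L-chain R (chain⁺ chain) z)))

  module NonChain (ext : IsExtension P R i) (x₀ : P.Carrier) (z-nonbasic : ¬ Basic R z) (wP : WellBased P) where
    open Extension ext
    private module wP = WellBased wP

    basic-cover : ∀ {c} → Basic R c → ∃[ p ] c ≡ i p × Basic P p
    basic-cover {c} bas with cover c
    ... | inj₁ refl       = contradiction bas z-nonbasic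
    ... | inj₂ (p , refl) = p , refl , basic⁻ bas

    wellBased : WellBased R
    wellBased = record
      { basics-antichain = anti
      ; basic-exists     = λ _ → let c , bas = wP.basic-exists x₀ in i c , basic⁺ bas
      ; universal        = univ
      }
      where
      anti : ∀ {c d} → Basic R c → Basic R d → Comparable R c d → c ≡ d
      anti bas bas′ cmp with basic-cover bas | basic-cover bas′
      ... | p , refl , basₚ | q , refl , bas_q = cong i (wP.basics-antichain basₚ bas_q (comparable⁻ cmp))
      univ : ∀ {a} → (∀ c → Basic R c → Comparable R a c) → Universal R a
      univ {a} cmp with cover a
      ... | inj₁ refl       = z-universal
      ... | inj₂ (p , refl) = universal⁺ (wP.universal λ c bas → comparable⁻ (cmp (i c) (basic⁺ bas)))

    -- As `z` is universal, an antichain containing it is `⁅ z ⁆`. The others stay inside `i(P)`,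
    -- where maximality in `P` and in `R` agree because `P` is nonempty.
    𝒜-onePoint : 𝒜 R ↭ ⁅ z ⁆ ∷ map image (𝒜 P)
    𝒜-onePoint = ↭-of-unique (𝒜-unique R)
      (All.tabulate fresh ∷ Unique.map⁺ image-injective (𝒜-unique P)) to from
      where
      fresh : ∀ {A} → A ∈ₗ map image (𝒜 P) → ⁅ z ⁆ ≢ A
      fresh A∈ z≡A with B , _ , refl ← ∈-map⁻ image A∈ =
        let p , _ , eq = ∈-image⁻ {B} (subst (z ∈_) z≡A (x∈⁅x⁆ z)) in z≢i p eq

      from : ∀ {A} → A ∈ₗ ⁅ z ⁆ ∷ map image (𝒜 P) → A ∈ₗ 𝒜 R
      from (here refl) = singleton∈𝒜 R z-universal
      from (there A∈) with B , B∈ , refl ← ∈-map⁻ image A∈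
        with anti , dom ← ∈𝒜⁻ P B∈ = ∈𝒜⁺ R (antichain-image anti) dom′
        where
        dom′ : Dominating R (image B)
        dom′ r with cover r
        -- Any member of `B` dominates `z`; one is found as the element that dominates `x₀`.
        ... | inj₁ refl       = let a , a∈ , _ = dom x₀ in i a , ∈-image⁺ a∈ , comparable-sym R (z-universal (i a))
        ... | inj₂ (p , refl) = let a , a∈ , c = dom p in i a , ∈-image⁺ a∈ , comparable⁺ c

      to : ∀ {A} → A ∈ₗ 𝒜 R → A ∈ₗ ⁅ z ⁆ ∷ map image (𝒜 P)
      to {A} A∈ with z ∈? A | ∈𝒜⁻ R A∈
      ... | yes z∈A | anti , _   = here (antichain∋universal R anti z∈A z-universal)
      ... | no z∉A  | anti , dom = there (subst (_∈ₗ map image (𝒜 P)) image-preimage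
                                     (∈-map⁺ image (∈𝒜⁺ P (antichain-preimage anti) dom′)))
        where
        inside-A : ∀ {r} → r ∈ A → ∃[ p ] r ≡ i p
        inside-A {r} r∈ with cover r
        ... | inj₁ refl = contradiction r∈ z∉A
        ... | inj₂ ins  = ins
        image⊆ : ∀ {r} → r ∈ image (preimage A) → r ∈ A
        image⊆ r∈ with p , p∈ , refl ← ∈-image⁻ r∈ = ∈-preimage⁻ p∈
        ⊆image : ∀ {r} → r ∈ A → r ∈ image (preimage A)
        ⊆image r∈ with p , refl ← inside-A r∈ = ∈-image⁺ (∈-preimage⁺ r∈)
        image-preimage : image (preimage A) ≡ A
        image-preimage = ⊆-antisym image⊆ ⊆image
        dom′ : Dominating P (preimage A)
        dom′ p with a , a∈ , c ← dom (i p) with q , refl ← inside-A a∈ = q , ∈-preimage⁺ a∈ , comparable⁻ c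

    L-onePoint : L R ↭ (0 , ∣P∣ R z) ∷ map (weight R ∘ image) (𝒜 P)
    L-onePoint = ↭-trans (map⁺ (weight R) 𝒜-onePoint)
      (↭-reflexive (cong₂ _∷_ (weight-singleton-nonbasic R z-nonbasic) (sym (map-∘ (𝒜 P)))))

-- A new least element.

module Least {P R : FinPoset} {i : FinPoset.Carrier P → FinPoset.Carrier R} {ℓ : FinPoset.Carrier R}
             (emb : IsEmbedding P R i) (cover : ∀ r → r ≡ ℓ ⊎ ∃[ p ] r ≡ i p)
             (ℓ<i : ∀ p → _<_ R ℓ (i p)) where
  private
    module P = FinPoset P
    module R = FinPoset R

  ℓ-universal : Universal R ℓ
  ℓ-universal r with cover r
  ... | inj₁ refl       = comparable-refl R
  ... | inj₂ (p , refl) = inj₁ (proj₁ (ℓ<i p))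

  open OnePoint emb cover (λ p → proj₂ (ℓ<i p)) ℓ-universal public

  module _ (¬chain : ¬ Chain P) (x₀ : P.Carrier) (wP : WellBased P) where
    private module wP = WellBased wP

    -- An incomparable pair of `P` lies above `ℓ` and violates (B.2).
    ℓ-nonbasic : ¬ Basic R ℓ
    ℓ-nonbasic (_ , b2 , _) = ¬chain λ u v → ¬incomparable P λ inc →
      b2 (i u , i v , inc ∘ IsEmbedding.comparable⁻ emb , ℓ<i u , ℓ<i v)

    least-extension : IsExtension P R i
    least-extension = record { isEmbedding = emb ; position = pos }
      where
      pos : ∀ r → Position P R i r
      pos r with cover r
      ... | inj₁ refl     = below ℓ<i ℓ-universal ℓ-nonbasic ¬chain
      ... | inj₂ (p , eq) = inside p eq

    open Extension least-extension
    open NonChain least-extension x₀ ℓ-nonbasic wP renaming (wellBased to least-wellBased) public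

    ℓ-lower : Lower R ℓ
    ℓ-lower = let c , bas = wP.basic-exists x₀ in ℓ-nonbasic , i c , basic⁺ bas , ℓ<i c

    -- If nothing above ℓ is incomparable to i p, then p is universal, so ℓ is
    -- a lower element associated to the same basic elements as i p.
    ℓ∉P : ∀ {p} → ¬ InP R (i p) ℓ
    ℓ∉P {p} (inj₁ (_ , p<ℓ , _)) = <-irrefl R p<ℓ (proj₁ (ℓ<i p))
    ℓ∉P {p} (inj₂ (_ , _ , none , ¬low)) = ¬low
      (ℓ-lower , (λ c _ → ℓ-universal c) , λ c bas ¬B _ → ¬B (bas , universal⁺ p-universal c))
      where
      p-universal : Universal P p
      p-universal w = ¬incomparable P λ inc → none (i w , ℓ<i w , inc ∘ comparable-sym P ∘ comparable⁻)

    ∣P∣-unchanged : ∀ p → ∣P∣ R (i p) ≡ ∣P∣ P p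
    ∣P∣-unchanged p = ∣P∣-inside ins
      where
      ins : ∀ {r} → InP R (i p) r → ∃[ q ] r ≡ i q
      ins {r} r∈P with cover r
      ... | inj₁ refl = contradiction r∈P ℓ∉P
      ... | inj₂ q    = q

    -- As `ℓ` is lower and universal, the incomparability clause excludes nothing and `P_ℓ` is all
    -- of `i(P)`.
    ∣P∣-ℓ : ∣P∣ R ℓ ≡ P.size
    ∣P∣-ℓ = trans
      (length-filter-allFin (λ _ → yes tt) (inP? R ℓ) injective
        (λ {p} _ → inj₁ (ℓ-lower , ℓ<i p , λ (c , _ , inc) → inc (comparable-sym R (ℓ-universal c)))) to)
      (trans (cong length (filter-all (λ _ → yes tt) (All.universal (λ _ → tt) (allFin P.size)))) (length-allFin P.size))
      where
      to : ∀ {r} → InP R ℓ r → ∃[ p ] r ≡ i p × ⊤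
      to {r} r∈P with cover r | r∈P
      ... | inj₂ (p , eq) | _                      = p , eq , tt
      ... | inj₁ refl     | inj₁ (_ , (_ , ne) , _) = contradiction refl ne
      ... | inj₁ refl     | inj₂ (_ , (_ , ne) , _) = contradiction refl ne

    L-least : L R ↭ L P ⊕ Y^ P.size
    L-least = begin
      L R                                                  ↭⟨ L-onePoint ⟩
      (0 , ∣P∣ R ℓ) ∷ map (weight R ∘ image) (𝒜 P)
        ≡⟨ cong₂ _∷_ (cong (0 ,_) ∣P∣-ℓ) (map-cong (λ A → weight-image {A} (λ {p} _ → ∣P∣-unchanged p)) (𝒜 P)) ⟩
      (0 , P.size) ∷ L P                                   ↭⟨ ∷↭∷ʳ (0 , P.size) (L P) ⟩
      L P ⊕ Y^ P.size                                      ∎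
      where open PermutationReasoning

-- Applied with `h` the height, `d x` the size of `P_x` and `n` the size of the poset. With
-- `k = length xs`, both sides enumerate the numbers from `n - k` to `n`: raising the exponents by
-- one vacates `n - k` and occupies `n`. The additive hypothesis guards against truncated
-- subtraction.
shift-heights : ∀ {C : Set} n {h d : C → ℕ} {xs} → (∀ {x} → x ∈ₗ xs → d x + suc (h x) ≡ n) →
                map h xs ↭ upTo (length xs) →
                n ∸ length xs ∷ map (suc ∘ d) xs ↭ n ∷ map d xs
shift-heights n {h} {d} {xs} eq heights = begin
  n ∸ k ∷ map (suc ∘ d) xs                  ≡⟨ cong (n ∸ k ∷_) (map-cong-local (All.tabulate suc-d)) ⟩
  n ∸ k ∷ map ((n ∸_) ∘ h) xs               ≡⟨ cong (n ∸ k ∷_) (map-∘ xs) ⟩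
  n ∸ k ∷ map (n ∸_) (map h xs)             ↭⟨ prep _ (map⁺ (n ∸_) heights) ⟩
  n ∸ k ∷ map (n ∸_) (upTo k)               ↭⟨ ∷↭∷ʳ _ _ ⟩
  map (n ∸_) (upTo k) ++ map (n ∸_) (k ∷ []) ≡⟨ map-++ (n ∸_) (upTo k) _ ⟨
  map (n ∸_) (upTo k ++ k ∷ [])             ≡⟨ cong (map (n ∸_)) (upTo-∷ʳ k) ⟩
  -- `upTo (suc k)` computes to `0 ∷ applyUpTo suc k`, and `n ∸ 0` to the new head `n`.
  n ∷ map (n ∸_) (applyUpTo suc k)          ≡⟨ cong (λ ks → n ∷ map (n ∸_) ks) (map-upTo suc k) ⟨
  n ∷ map (n ∸_) (map suc (upTo k))         ↭⟨ prep n (map⁺ (n ∸_) (map⁺ suc (↭-sym heights))) ⟩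
  n ∷ map (n ∸_) (map suc (map h xs))       ≡⟨ cong (n ∷_) (trans (cong (map (n ∸_)) (sym (map-∘ xs))) (sym (map-∘ xs))) ⟩
  n ∷ map ((n ∸_) ∘ suc ∘ h) xs             ≡⟨ cong (n ∷_) (map-cong-local (All.tabulate d-eq)) ⟩
  n ∷ map d xs                              ∎
  where
  open PermutationReasoning
  k = length xs
  suc-d : ∀ {x} → x ∈ₗ xs → suc (d x) ≡ n ∸ h x
  suc-d {x} x∈ = trans (sym (ℕₚ.m+n∸n≡m (suc (d x)) (h x))) (cong (_∸ h x) (trans (sym (ℕₚ.+-suc (d x) (h x))) (eq x∈)))
  d-eq : ∀ {x} → x ∈ₗ xs → n ∸ suc (h x) ≡ d x
  d-eq {x} x∈ = trans (cong (_∸ suc (h x)) (sym (eq x∈))) (ℕₚ.m+n∸n≡m (d x) (suc (h x)))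

-- The lower universal elements are the only ones whose P_a gains a new greatest
-- element.  They form a chain u₀ < … < uₖ₋₁ at the bottom of P, with |P_uₕ| = |P| - 1 - h.

module Bottom (P : FinPoset) (wP : WellBased P) where
  open FinPoset P
  open IsDecPartialOrder isDecPartialOrder using () renaming (trans to ≤-trans)
  open WellBased wP

  InBottom : Pred Carrier 0ℓ
  InBottom p = Lower P p × Universal P p

  inBottom? : Decidable InBottom
  inBottom? p = lower? P p ×-dec universal? P p

  bottom : List Carrier
  bottom = filter inBottom? (allFin size)

  ∈-bottom⁻ : ∀ {p} → p ∈ₗ bottom → InBottom p
  ∈-bottom⁻ p∈ = proj₂ (∈-filter⁻ inBottom? {xs = allFin size} p∈)

  -- Everything strictly below a lower element is strictly below a basic element `c`, hence not
  -- basic, since the basic elements form an antichain.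
  bottom-downward : ∀ {u v} → InBottom v → _<_ P u v → InBottom u
  bottom-downward {u} {v} ((_ , c , bas , v<c) , univ) u<v =
    ((λ basᵤ → proj₂ u<c (basics-antichain basᵤ bas (inj₁ (proj₁ u<c)))) , c , bas , u<c) , univ′
    where
    u<c = <-trans P u<v v<c
    univ′ : Universal P u
    univ′ w with comparable⇒≡⊎<⊎> P (univ w)
    ... | inj₁ refl       = inj₁ (proj₁ u<v)
    ... | inj₂ (inj₁ v<w) = inj₁ (≤-trans (proj₁ u<v) (proj₁ v<w))
    -- Both `u` and `w` lie below the basic element `c`, so (B.1) for `c` makes them comparable.
    ... | inj₂ (inj₂ w<v) = ¬incomparable P λ inc → proj₁ bas (u , w , inc , u<c , <-trans P w<v v<c)

  bottom-heights : map (height P) bottom ↭ upTo (length bottom)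
  bottom-heights = map-height-↭ P inBottom? (λ (_ , univ) _ → univ _) bottom-downward

  -- The poset splits into the elements above `u`, which form `P_u` because `u` is lower and
  -- universal, then `u` itself, and the `height P u` elements below it.
  ∣P∣-bottom : ∀ {u} → InBottom u → ∣P∣ P u + suc (height P u) ≡ size
  ∣P∣-bottom {u} ((¬bas , low) , univ) = sym (begin
    size                                    ≡⟨ length-allFin size ⟨
    length (allFin size)                    ≡⟨ ↭-length split ⟩
    length (over ++ u ∷ under)              ≡⟨ length-++ over ⟩
    length over + suc (height P u)          ≡⟨ cong (_+ suc (height P u)) ∣over∣ ⟩
    ∣P∣ P u + suc (height P u)              ∎)
    where
    open ≡-Reasoning
    over = filter (λ v → _<?_ P u v) (allFin size)
    under = filter (λ v → _<?_ P v u) (allFin size)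
    over⁻ : ∀ {v} → v ∈ₗ over → _<_ P u v
    over⁻ v∈ = proj₂ (∈-filter⁻ (λ v → _<?_ P u v) {xs = allFin size} v∈)
    under⁻ : ∀ {v} → v ∈ₗ under → _<_ P v u
    under⁻ v∈ = proj₂ (∈-filter⁻ (λ v → _<?_ P v u) {xs = allFin size} v∈)
    split : allFin size ↭ over ++ u ∷ under
    split = ↭-of-unique (Unique.allFin⁺ size)
      (Unique.++⁺ (filter-allFin-unique (λ v → _<?_ P u v))
        (All.tabulate (λ v∈ u≡v → proj₂ (under⁻ v∈) (sym u≡v)) ∷ filter-allFin-unique (λ v → _<?_ P v u))
        λ where (p , here refl) → proj₂ (over⁻ p) refl
                (p , there q)   → <-irrefl P (over⁻ p) (proj₁ (under⁻ q)))
      to (λ _ → ∈-allFin _)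
      where
      to : ∀ {v} → v ∈ₗ allFin size → v ∈ₗ over ++ u ∷ under
      to {v} _ with comparable⇒≡⊎<⊎> P (univ v)
      ... | inj₁ refl       = ∈-++⁺ʳ over (here refl)
      ... | inj₂ (inj₁ u<v) = ∈-++⁺ˡ (∈-filter-allFin (λ v → _<?_ P u v) u<v)
      ... | inj₂ (inj₂ v<u) = ∈-++⁺ʳ over (there (∈-filter-allFin (λ v → _<?_ P v u) v<u))
    inP⇒< : ∀ {v} → InP P u v → _<_ P u v
    inP⇒< (inj₁ (_ , u<v , _)) = u<v
    -- If `u` were upper as well, it would lie strictly between two basic elements.
    inP⇒< (inj₂ ((_ , c , bas , c<u) , _)) =
      let d , bas′ , u<d = low ; c<d = <-trans P c<u u<d in
      contradiction (basics-antichain bas bas′ (inj₁ (proj₁ c<d))) (proj₂ c<d)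
    ∣over∣ : length over ≡ ∣P∣ P u
    ∣over∣ = length-filter-allFin (inP? P u) (λ v → _<?_ P u v) id inP⇒<
      λ u<v → _ , refl , inj₁ ((¬bas , low) , u<v , λ (c , _ , inc) → inc (comparable-sym P (univ c)))

  MeetsBottom : Pred (Subset size) 0ℓ
  MeetsBottom A = ∃[ u ] u ∈ A × InBottom u

  meetsBottom? : Decidable MeetsBottom
  meetsBottom? A = any? λ u → (u ∈? A) ×-dec inBottom? u

  𝒜-avoiding : List (Subset size)
  𝒜-avoiding = filter (¬? ∘ meetsBottom?) (𝒜 P)

  -- Members of `bottom` are universal, so a maximal antichain meeting `bottom` is a singleton. The
  -- other antichains keep their monomials when a greatest element is added.
  𝒜-split : 𝒜 P ↭ map ⁅_⁆ bottom ++ 𝒜-avoiding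
  𝒜-split = ↭-trans (filter-partition-↭ meetsBottom? (𝒜 P)) (++⁺ʳ 𝒜-avoiding
    (↭-of-unique (Unique.filter⁺ meetsBottom? (𝒜-unique P)) (Unique.map⁺ ⁅⁆-injective (filter-allFin-unique inBottom?)) to from))
    where
    to : ∀ {A} → A ∈ₗ filter meetsBottom? (𝒜 P) → A ∈ₗ map ⁅_⁆ bottom
    to A∈ = let A∈𝒜 , u , u∈A , ub = ∈-filter⁻ meetsBottom? {xs = 𝒜 P} A∈ in
      subst (_∈ₗ map ⁅_⁆ bottom) (sym (antichain∋universal P (proj₁ (∈𝒜⁻ P A∈𝒜)) u∈A (proj₂ ub)))
        (∈-map⁺ ⁅_⁆ (∈-filter-allFin inBottom? ub))
    from : ∀ {A} → A ∈ₗ map ⁅_⁆ bottom → A ∈ₗ filter meetsBottom? (𝒜 P)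
    from A∈ = let u , u∈ , eq = ∈-map⁻ ⁅_⁆ A∈ ; ub = ∈-bottom⁻ u∈ in
      subst (_∈ₗ filter meetsBottom? (𝒜 P)) (sym eq)
        (∈-filter⁺ meetsBottom? (singleton∈𝒜 P (proj₂ ub)) (u , x∈⁅x⁆ u , ub))

-- A new greatest element.

module Greatest {P R : FinPoset} {i : FinPoset.Carrier P → FinPoset.Carrier R} {g : FinPoset.Carrier R}
                (emb : IsEmbedding P R i) (cover : ∀ r → r ≡ g ⊎ ∃[ p ] r ≡ i p)
                (i<g : ∀ p → _<_ R (i p) g) where
  private
    module P = FinPoset P
    module R = FinPoset R

  g-universal : Universal R g
  g-universal r with cover r
  ... | inj₁ refl       = comparable-refl R
  ... | inj₂ (p , refl) = inj₂ (proj₁ (i<g p))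

  open OnePoint emb cover (λ p → proj₂ (i<g p) ∘ sym) g-universal public

  module _ (¬chain : ¬ Chain P) (x₀ : P.Carrier) (wP : WellBased P) where
    private module wP = WellBased wP
    open Bottom P wP

    -- An incomparable pair of `P` lies below `g` and violates (B.1).
    g-nonbasic : ¬ Basic R g
    g-nonbasic (b1 , _) = ¬chain λ u v → ¬incomparable P λ inc →
      b1 (i u , i v , inc ∘ IsEmbedding.comparable⁻ emb , i<g u , i<g v)

    greatest-extension : IsExtension P R i
    greatest-extension = record { isEmbedding = emb ; position = pos }
      where
      pos : ∀ r → Position P R i r
      pos r with cover r
      ... | inj₁ refl     = above i<g g-universal g-nonbasic
      ... | inj₂ (p , eq) = inside p eq

    open Extension greatest-extension
    open NonChain greatest-extension x₀ g-nonbasic wP renaming (wellBased to greatest-wellBased) public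

    g-upper : Upper R g
    g-upper = let c , bas = wP.basic-exists x₀ in g-nonbasic , i c , basic⁺ bas , i<g c

    inBottom⇒g∈P : ∀ {p} → InBottom p → InP R (i p) g
    inBottom⇒g∈P {p} (low , univ) = inj₁ (lower⁺ low , i<g p , λ (c , _ , inc) → inc (comparable-sym R (universal⁺ univ c)))

    -- All of `i(P)` lies below `g`, so the incomparability clause for `g` says that `p` is
    -- universal.
    g∈P⇒inBottom : ∀ {p} → InP R (i p) g → InBottom p
    g∈P⇒inBottom {p} (inj₁ (low , _ , none)) =
      lower⁻ low , λ w → ¬incomparable P λ inc → none (i w , i<g w , inc ∘ comparable-sym P ∘ comparable⁻)
    g∈P⇒inBottom {p} (inj₂ (_ , g<p , _)) = contradiction (proj₁ (i<g p)) (<-irrefl R g<p)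

    ∣P∣-suc : ∀ {p} → InBottom p → ∣P∣ R (i p) ≡ suc (∣P∣ P p)
    ∣P∣-suc p∈ = ∣P∣-inside-suc (λ q → proj₂ (i<g q) ∘ sym) (inBottom⇒g∈P p∈) cover

    ∣P∣-unchanged : ∀ {p} → ¬ InBottom p → ∣P∣ R (i p) ≡ ∣P∣ P p
    ∣P∣-unchanged {p} p∉ = ∣P∣-inside ins
      where
      ins : ∀ {r} → InP R (i p) r → ∃[ q ] r ≡ i q
      ins {r} r∈P with cover r
      ... | inj₁ refl = contradiction (g∈P⇒inBottom r∈P) p∉
      ... | inj₂ q    = q

    -- As `g` is comparable to every basic element, `P_g` omits the lower elements comparable to all
    -- basic elements; by `wP.universal` these are the members of `bottom`.
    ∣P∣-g : ∣P∣ R g ≡ P.size ∸ length bottom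
    ∣P∣-g = trans (length-filter-allFin (¬? ∘ inBottom?) (inP? R g) injective from to) (sym (begin
      P.size ∸ length bottom                                  ≡⟨ cong (_∸ length bottom) (length-allFin P.size) ⟨
      length (allFin P.size) ∸ length bottom                  ≡⟨ cong (_∸ length bottom) (↭-length (filter-partition-↭ inBottom? (allFin P.size))) ⟩
      length (bottom ++ rest) ∸ length bottom                 ≡⟨ cong (_∸ length bottom) (length-++ bottom) ⟩
      length bottom + length rest ∸ length bottom             ≡⟨ ℕₚ.m+n∸m≡n (length bottom) (length rest) ⟩
      length rest                                             ∎))
      where
      open ≡-Reasoning
      rest = filter (¬? ∘ inBottom?) (allFin P.size)
      from : ∀ {p} → ¬ InBottom p → InP R g (i p)
      from {p} p∉ = inj₂ (g-upper , i<g p , (λ (c , _ , inc) → inc (comparable-sym R (g-universal c))) ,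
        λ (low , comp , _) → p∉ (lower⁻ low , wP.universal λ c bas →
          comparable⁻ (comp (i c) (basic⁺ bas , g-universal (i c)))))
      to : ∀ {r} → InP R g r → ∃[ p ] r ≡ i p × ¬ InBottom p
      to {r} r∈P with cover r | r∈P
      ... | inj₁ refl | inj₁ (_ , (_ , ne) , _) = contradiction refl ne
      ... | inj₁ refl | inj₂ (_ , (_ , ne) , _) = contradiction refl ne
      ... | inj₂ (p , refl) | inj₁ (_ , g<p , _) = contradiction (proj₁ (i<g p)) (<-irrefl R g<p)
      ... | inj₂ (p , refl) | inj₂ (_ , _ , _ , ¬low) = p , refl , λ (low , univ) →
        ¬low (lower⁺ low , (λ c _ → universal⁺ univ c) , λ c bas ¬B _ → ¬B (bas , g-universal c))

    image-singleton : ∀ p → image ⁅ p ⁆ ≡ ⁅ i p ⁆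
    image-singleton p = ⊆-antisym to from
      where
      to : ∀ {r} → r ∈ image ⁅ p ⁆ → r ∈ ⁅ i p ⁆
      to r∈ with q , q∈ , refl ← ∈-image⁻ r∈ with refl ← x∈⁅y⁆⇒x≡y p q∈ = x∈⁅x⁆ (i p)
      from : ∀ {r} → r ∈ ⁅ i p ⁆ → r ∈ image ⁅ p ⁆
      from r∈ with refl ← x∈⁅y⁆⇒x≡y (i p) r∈ = ∈-image⁺ (x∈⁅x⁆ p)

    weight-bottom : ∀ {u} → u ∈ₗ bottom → weight P ⁅ u ⁆ ≡ (0 , ∣P∣ P u)
    weight-bottom u∈ = weight-singleton-nonbasic P (proj₁ (proj₁ (∈-bottom⁻ u∈)))

    weight-image-bottom : ∀ {u} → u ∈ₗ bottom → weight R (image ⁅ u ⁆) ≡ (0 , suc (∣P∣ P u))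
    weight-image-bottom {u} u∈ with ub@((¬bas , _) , _) ← ∈-bottom⁻ u∈ = trans (cong (weight R) (image-singleton u))
      (trans (weight-singleton-nonbasic R (¬bas ∘ basic⁻)) (cong (0 ,_) (∣P∣-suc ub)))

    weight-avoiding : ∀ {A} → A ∈ₗ 𝒜-avoiding → weight R (image A) ≡ weight P A
    weight-avoiding {A} A∈ with _ , avoids ← ∈-filter⁻ (¬? ∘ meetsBottom?) {xs = 𝒜 P} A∈ =
      weight-image {A} λ {p} p∈ → ∣P∣-unchanged λ pb → avoids (p , p∈ , pb)

    L-greatest : L R ↭ L P ⊕ Y^ P.size
    L-greatest = begin
      L R
        ↭⟨ L-onePoint ⟩
      (0 , ∣P∣ R g) ∷ map (weight R ∘ image) (𝒜 P)
        ↭⟨ prep _ (map⁺ (weight R ∘ image) 𝒜-split) ⟩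
      (0 , ∣P∣ R g) ∷ map (weight R ∘ image) (map ⁅_⁆ bottom ++ 𝒜-avoiding)
        ≡⟨ cong₂ _∷_ (cong (0 ,_) ∣P∣-g) (split (weight R ∘ image) weight-image-bottom weight-avoiding) ⟩
      map (0 ,_) (P.size ∸ length bottom ∷ map (suc ∘ ∣P∣ P) bottom) ++ map (weight P) 𝒜-avoiding
        -- The exponent of `⁅ g ⁆` fills the gap left below the raised exponents of `bottom`, so in
        -- total only the exponent `P.size` is new.
        ↭⟨ ++⁺ʳ _ (map⁺ (0 ,_) (shift-heights P.size (∣P∣-bottom ∘ ∈-bottom⁻) bottom-heights)) ⟩
      map (0 ,_) (P.size ∷ map (∣P∣ P) bottom) ++ map (weight P) 𝒜-avoiding
        ≡⟨ cong ((0 , P.size) ∷_) (split (weight P) weight-bottom (λ _ → refl)) ⟨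
      (0 , P.size) ∷ map (weight P) (map ⁅_⁆ bottom ++ 𝒜-avoiding)
        ↭⟨ prep _ (map⁺ (weight P) (↭-sym 𝒜-split)) ⟩
      (0 , P.size) ∷ L P
        ↭⟨ ∷↭∷ʳ (0 , P.size) (L P) ⟩
      L P ⊕ Y^ P.size ∎
      where
      open PermutationReasoning
      -- Evaluates the monomials in `P` and those of the images in `R` alike; the two differ only in
      -- the exponents `d` on `bottom`.
      split : ∀ (w : Subset P.size → ℕ × ℕ) {d : P.Carrier → ℕ} →
              (∀ {u} → u ∈ₗ bottom → w ⁅ u ⁆ ≡ (0 , d u)) → (∀ {A} → A ∈ₗ 𝒜-avoiding → w A ≡ weight P A) →
              map w (map ⁅_⁆ bottom ++ 𝒜-avoiding) ≡ map (0 ,_) (map d bottom) ++ map (weight P) 𝒜-avoiding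
      split w eq eq′ = trans (map-++ w (map ⁅_⁆ bottom) 𝒜-avoiding) (cong₂ _++_
        (trans (sym (map-∘ bottom)) (trans (map-cong-local (All.tabulate eq)) (map-∘ bottom)))
        (map-cong-local (All.tabulate eq′)))

-- 𝒱-posets

module Inverse {R : FinPoset} {A : Set} {_≲_ : Rel A 0ℓ} (iso : R ≅ _≲_) where
  open FinPoset R
  private
    f = proj₁ iso
    module f = IsOrderIsomorphism (proj₂ iso)

  -- The constructors give an isomorphism out of `R`, whereas embeddings of the parts into `R` need
  -- its inverse, read off from surjectivity.
  inv : A → Carrier
  inv y = proj₁ (f.surjective y)

  f-inv : ∀ y → f (inv y) ≡ y
  f-inv y = proj₂ (f.surjective y) refl

  inv-of : ∀ {r y} → f r ≡ y → r ≡ inv y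
  inv-of {y = y} eq = f.injective (trans eq (sym (f-inv y)))

  inv-mono : ∀ {x y} → x ≲ y → inv x ≤ inv y
  inv-mono {x} {y} le = f.cancel (subst₂ _≲_ (sym (f-inv x)) (sym (f-inv y)) le)

  inv-cancel : ∀ {x y} → inv x ≤ inv y → x ≲ y
  inv-cancel {x} {y} le = subst₂ _≲_ (f-inv x) (f-inv y) (f.mono le)

  inv-injective : ∀ {x y} → inv x ≡ inv y → x ≡ y
  inv-injective {x} {y} eq = trans (sym (f-inv x)) (trans (cong f eq) (f-inv y))

empty-wellBased : ∀ {R} → FinPoset.size R ≡ 0 → WellBased R
empty-wellBased {R} eq = record
  { basics-antichain = λ {b} → absurd b ; basic-exists = absurd ; universal = λ {a} → absurd a }
  where
  absurd : {C : Set} → FinPoset.Carrier R → C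
  absurd r with () ← subst Fin eq r

L-empty : ∀ {R} → FinPoset.size R ≡ 0 → L R ≡ 1ₚ
L-empty {record { size = zero }} _ = refl

𝒱-union : ∀ {P Q R p q} → R ≅ Pointwise (FinPoset._≤_ P) (FinPoset._≤_ Q) →
          WellBased P × p ↭ L P → WellBased Q × q ↭ L Q → WellBased R × p ⊗ q ↭ L R
𝒱-union {P} {Q} {R} {p} {q} iso (wP , p↭) (wQ , q↭) = union-wellBased wP wQ , ↭-trans
  (↭-trans (cartesianProductWith-↭ˡ _ q p↭) (cartesianProductWith-↭ʳ _ (L P) q↭)) (↭-sym L-union)
  where
  open Inverse {R} iso
  disjoint : ∀ x y → Incomparable R (inv (inj₁ x)) (inv (inj₂ y))
  disjoint x y (inj₁ le) with () ← inv-cancel le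
  disjoint x y (inj₂ le) with () ← inv-cancel le
  cover : ∀ r → (∃[ x ] r ≡ inv (inj₁ x)) ⊎ (∃[ y ] r ≡ inv (inj₂ y))
  cover r with proj₁ iso r in eq
  ... | inj₁ x = inj₁ (x , inv-of eq)
  ... | inj₂ y = inj₂ (y , inv-of eq)
  positionᵢ : ∀ r → Position P R (inv ∘ inj₁) r
  positionᵢ r with cover r
  ... | inj₁ (x , eq)   = inside x eq
  ... | inj₂ (y , refl) = apart λ x → disjoint x y ∘ comparable-sym R
  positionⱼ : ∀ r → Position Q R (inv ∘ inj₂) r
  positionⱼ r with cover r
  ... | inj₁ (x , refl) = apart λ y → disjoint x y
  ... | inj₂ (y , eq)   = inside y eq
  cancelᵢ : ∀ {x y} → Pointwise (FinPoset._≤_ P) (FinPoset._≤_ Q) (inj₁ x) (inj₁ y) → FinPoset._≤_ P x y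
  cancelᵢ (Pw.inj₁ le) = le
  cancelⱼ : ∀ {x y} → Pointwise (FinPoset._≤_ P) (FinPoset._≤_ Q) (inj₂ x) (inj₂ y) → FinPoset._≤_ Q x y
  cancelⱼ (Pw.inj₂ le) = le
  extᵢ : IsExtension P R (inv ∘ inj₁)
  extᵢ = record
    { isEmbedding = record { mono = inv-mono ∘ Pw.inj₁ ; cancel = cancelᵢ ∘ inv-cancel }
    ; position    = positionᵢ
    }
  extⱼ : IsExtension Q R (inv ∘ inj₂)
  extⱼ = record
    { isEmbedding = record { mono = inv-mono ∘ Pw.inj₂ ; cancel = cancelⱼ ∘ inv-cancel }
    ; position    = positionⱼ
    }
  open Union extᵢ extⱼ cover disjoint

-- The empty poset is a chain, so a failure of `Chain` exhibits an element.
¬chain⇒nonempty : ∀ {P} → ¬ Chain P → FinPoset.Carrier P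
¬chain⇒nonempty {P} ¬chain = proj₁ (Finₚ.¬∀⟶∃¬ (FinPoset.size P) (Universal P) (universal? P) ¬chain)

extend-nonempty : ∀ {n} → Fin n → ∀ p → extend n p ≡ p ⊕ Y^ n
extend-nonempty {suc _} _ _ = refl

module GreatestOf {P R : FinPoset} (iso : R ≅ Sup._≤⁺_ (FinPoset._≤_ P)) where
  open Inverse {R} iso

  cover : ∀ r → r ≡ inv ⊤⁺ ⊎ ∃[ p ] r ≡ inv [ p ]
  cover r with proj₁ iso r in eq
  ... | ⊤⁺    = inj₁ (inv-of eq)
  ... | [ p ] = inj₂ (p , inv-of eq)

  emb : IsEmbedding P R (inv ∘ [_])
  emb = record { mono = inv-mono ∘ Sup.[_] ; cancel = Sup.[≤]-injective _ ∘ inv-cancel }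

  i<g : ∀ p → _<_ R (inv [ p ]) (inv ⊤⁺)
  i<g p = inv-mono ([ p ] Sup.≤⊤⁺) , λ eq → case inv-injective eq of λ ()

  open Greatest emb cover i<g public

-- The case of chains includes the empty poset, where `extend` gives `X`; a poset that is not a
-- chain is nonempty, so there `extend` adds a power of y.
𝒱-greatest : ∀ {P R p} → R ≅ Sup._≤⁺_ (FinPoset._≤_ P) → WellBased P × p ↭ L P →
             WellBased R × extend (FinPoset.size P) p ↭ L R
𝒱-greatest {P} {R} {p} iso (wP , p↭) = by-cases (chain? P)
  where
  open GreatestOf {P} {R} iso
  by-cases : Dec (Chain P) → WellBased R × extend (FinPoset.size P) p ↭ L R
  by-cases (yes chain) = chain-wellBased R (chain⁺ chain) , L-chain-extend chain p↭
  by-cases (no ¬chain) = greatest-wellBased ¬chain x₀ wP , ↭-trans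
    (↭-reflexive (extend-nonempty x₀ p)) (↭-trans (++⁺ʳ _ p↭) (↭-sym (L-greatest ¬chain x₀ wP)))
    where x₀ = ¬chain⇒nonempty {P} ¬chain

module LeastOf {P R : FinPoset} (iso : R ≅ Inf._≤₋_ (FinPoset._≤_ P)) where
  open Inverse {R} iso

  cover : ∀ r → r ≡ inv ⊥₋ ⊎ ∃[ p ] r ≡ inv [ p ]
  cover r with proj₁ iso r in eq
  ... | ⊥₋    = inj₁ (inv-of eq)
  ... | [ p ] = inj₂ (p , inv-of eq)

  emb : IsEmbedding P R (inv ∘ [_])
  emb = record { mono = inv-mono ∘ Inf.[_] ; cancel = Inf.[≤]-injective _ ∘ inv-cancel }

  ℓ<i : ∀ p → _<_ R (inv ⊥₋) (inv [ p ])
  ℓ<i p = inv-mono (Inf.⊥₋≤ [ p ]) , λ eq → case inv-injective eq of λ ()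

  open Least emb cover ℓ<i public

-- A least element below a nonempty chain takes over as the only basic element, so chains go through
-- `L-chain-extend` and not through `IsExtension`.
𝒱-least : ∀ {P R p} → R ≅ Inf._≤₋_ (FinPoset._≤_ P) → WellBased P × p ↭ L P →
          WellBased R × extend (FinPoset.size P) p ↭ L R
𝒱-least {P} {R} {p} iso (wP , p↭) = by-cases (chain? P)
  where
  open LeastOf {P} {R} iso
  by-cases : Dec (Chain P) → WellBased R × extend (FinPoset.size P) p ↭ L R
  by-cases (yes chain) = chain-wellBased R (chain⁺ chain) , L-chain-extend chain p↭
  by-cases (no ¬chain) = least-wellBased ¬chain x₀ wP , ↭-trans
    (↭-reflexive (extend-nonempty x₀ p)) (↭-trans (++⁺ʳ _ p↭) (↭-sym (L-least ¬chain x₀ wP)))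
    where x₀ = ¬chain⇒nonempty {P} ¬chain

-- Well-basedness is proved along with the permutation, since adding an extremum requires it of the
-- smaller poset.
𝒫-↭-L : ∀ {P} (v : 𝒱-Poset P) → WellBased P × 𝒫 v ↭ L P
𝒫-↭-L (empty {R} eq)     = empty-wellBased {R} eq , ↭-reflexive (sym (L-empty {R} eq))
𝒫-↭-L (union v w iso)    = 𝒱-union iso (𝒫-↭-L v) (𝒫-↭-L w)
𝒫-↭-L (greatest v iso)   = 𝒱-greatest iso (𝒫-↭-L v)
𝒫-↭-L (least v iso)      = 𝒱-least iso (𝒫-↭-L v)

theorem3p17 : ∀ (P : FinPoset) (v : 𝒱-Poset P) → 𝒫 v ≈ L P
theorem3p17 P v = ↭⇒≈ (proj₂ (𝒫-↭-L v))
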